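{- Let $\rho_1,\rho_2:W_F\to\mathrm{GL}_2(\overline{\mathbb{Q}}_\ell)$ be two special representations such that $\rho_1(W_F),\rho_2(W_F)\subset\mathrm{GL}_2(\mathcal{O}_K)$, with associated Weil--Deligne representations $\chi\omega\oplus\chi$ and $\theta\omega\oplus\theta$, respectively, where $\chi,\theta$ are $1$-dimensional representations of $W_F$. Suppose (as may be assumed without loss of generality) that there are upper triangular matrices $U_j=\begin{pmatrix}a_j&b_j\\0&d_j\end{pmatrix}\in\mathrm{GL}_2(K)$, $j=1,2$, such that for all $k\in\mathbb{Z}$, $\tau\in I_F$, $$\rho_1(\Phi^k\tau)=\begin{pmatrix}\chi\omega(\Phi^k\tau)&\frac{a_1}{d_1}t_\ell(\tau)\chi\omega(\Phi^k\tau)+\frac{b_1}{d_1}(\chi(\Phi^k\tau)-\chi\omega(\Phi^k\tau))\\0&\chi(\Phi^k\tau)\end{pmatrix},$$ $$\rho_2(\Phi^k\tau)=\begin{pmatrix}\theta\omega(\Phi^k\tau)&\frac{a_2}{d_2}t_\ell(\tau)\theta\omega(\Phi^k\tau)+\frac{b_2}{d_2}(\theta(\Phi^k\tau)-\theta\omega(\Phi^k\tau))\\0&\theta(\Phi^k\tau)\end{pmatrix}.$$ Suppose that $a_1/d_1,\,a_2/d_2\in\mathcal{O}_K^\times$. Then $\overline{\rho}_1\cong\overline{\rho}_2$ if and only if $\overline{\chi}=\overline{\theta}$ and $$v\left(\frac{a_2b_1-a_1b_2}{a_1d_2}\right)\geq\min\{0,1-i\},$$ where $i$ is the maximal nonnegative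 integer such that $q\equiv1\pmod{\lambda^i}$.
   Context: $p\neq\ell$ are odd primes. $F/\mathbb{Q}_p$ is a finite extension with residue field of order $q$, Weil group $W_F$ and inertia group $I_F$. $\Phi\in W_F$ is a fixed Frobenius element, and $\omega$ is the character of $W_F$ with $\omega(\Phi^k\tau)=q^{ -k}$ for $k\in\mathbb{Z}$, $\tau\in I_F$. $t_\ell:I_F\to\mathbb{Z}_\ell$ is a fixed continuous surjective homomorphism; it satisfies $t_\ell(g\tau g^{ -1})=\omega(g)t_\ell(\tau)$. $K/\mathbb{Q}_\ell$ is a finite extension with ring of integers $\mathcal{O}_K$, maximal ideal $\lambda$, and normalized valuation $v$ (a uniformizer has valuation $1$, $v(0)=\infty$). A bar denotes reduction modulo $\lambda$. All representations are continuous. The Weil--Deligne representation associated with a continuous $\rho$ is $(\rho_\Phi,N_\rho)$, where $N_\rho$ is the unique nilpotent matrix with $\rho(\tau)=\exp(t_\ell(\tau)N_\rho)$ for $\tau$ in some open subgroup of $I_F$, and $\rho_\Phi(\Phi^k\tau)=\rho(\Phi^k\tau)\exp(-t_\ell(\tau)N_\rho)$. $\rho$ is called special if its Weil--Deligne representation is isomorphic to $\left(\chi\omega\oplus\chi,\begin{pmatrix}0&1\\0&0\end{pmatrix}\right)$ for some $1$-dimensional representation $\chi$ of $W_F$. -}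

module Defs where

open import Level using (0ℓ)
open import Algebra.Bundles
  using (CommutativeRing; Group; RawGroup; RawMonoid; Semiring)
open import Algebra.Core using (Op₂)
open import Algebra.Morphism.Structures
  using (IsMonoidHomomorphism; IsGroupHomomorphism; IsRingHomomorphism; IsRingMonomorphism)
import Algebra.Morphism.Construct.Composition as Composition
import Algebra.Morphism.Construct.Identity as Identity
import Algebra.Definitions.RawMonoid as RawMonoidDefs
import Algebra.Definitions.RawSemiring as RawSemiringDefs
import Algebra.Properties.CommutativeSemigroup as CommutativeSemigroupProperties
import Algebra.Properties.Group as GroupProperties
import Algebra.Properties.Ring as RingProperties
import Algebra.Properties.Semiring.Exp as Exp
open import Data.Fin.Base using (Fin)
open import Data.Integer.Base as ℤ using (ℤ; +_; -[1+_]; 0ℤ; 1ℤ)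
import Data.Integer.Properties as ℤ
open import Data.Integer.Divisibility.Signed
  using (∣m∣n⇒∣m+n; ∣m⇒∣-m; ∣m⇒∣m*n; ∣n⇒∣m*n)
  renaming (_∣_ to _∣ℤ_; divides to dividesℤ)
open import Data.Integer.Tactic.RingSolver using (solve-∀)
open import Data.List.Base using (List; []; _∷_; map)
open import Data.List.Relation.Unary.All using (All)
open import Data.Nat.Base as ℕ using (ℕ; zero; suc)
import Data.Nat.Properties as ℕ
open import Data.Product.Base using (Σ; Σ-syntax; ∃; ∃-syntax; _×_; _,_; proj₁; proj₂)
open import Data.Rational.Base as ℚ using (ℚ; 0ℚ; 1ℚ)
import Data.Rational.Properties as ℚ
open import Data.Sum.Base using (_⊎_; inj₁; inj₂)
open import Data.Unit.Base using (⊤; tt)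
open import Function.Base using (_∘_)
open import Function.Bundles using (Bijection; _⇔_; module Equivalence)
open import Function.Definitions using (Surjective)
open import Relation.Binary.Core using (Rel)
open import Relation.Binary.Construct.Add.Supremum.NonStrict using ([_]; _≤⊤⁺)
  renaming (_≤⁺_ to ≤⁺-over)
open import Relation.Binary.PropositionalEquality as ≡ using (_≡_)
open import Relation.Nullary.Construct.Add.Supremum using (_⁺; ⊤⁺; [_]; []-injective)
open import Relation.Nullary.Negation.Core using (¬_; contradiction)

zpow : ∀ {c ℓ} (G : RawGroup c ℓ) → RawGroup.Carrier G → ℤ → RawGroup.Carrier G
zpow G x (+ n)    = RawMonoidDefs._×_ (RawGroup.rawMonoid G) n x
zpow G x -[1+ n ] = RawMonoidDefs._×_ (RawGroup.rawMonoid G) (suc n) (RawGroup._⁻¹ G x)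

record Subgroup (G : Group 0ℓ 0ℓ) : Set₁ where
  open Group G
  field
    Mem       : Carrier → Set
    ε-mem     : Mem ε
    ∙-mem     : ∀ {x y} → Mem x → Mem y → Mem (x ∙ y)
    ⁻¹-mem    : ∀ {x} → Mem x → Mem (x ⁻¹)
    mem-resp  : ∀ {x y} → x ≈ y → Mem x → Mem y

subgroup : (G : Group 0ℓ 0ℓ) → Subgroup G → Group 0ℓ 0ℓ
subgroup G H = record
  { Carrier = Σ Carrier Mem
  ; _≈_     = λ x y → proj₁ x ≈ proj₁ y
  ; _∙_     = λ x y → proj₁ x ∙ proj₁ y , ∙-mem (proj₂ x) (proj₂ y)
  ; ε       = ε , ε-mem
  ; _⁻¹     = λ x → proj₁ x ⁻¹ , ⁻¹-mem (proj₂ x)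
  ; isGroup = record
    { isMonoid = record
      { isSemigroup = record
        { isMagma = record
          { isEquivalence = record { refl = refl ; sym = sym ; trans = trans }
          ; ∙-cong = ∙-cong
          }
        ; assoc = λ x y z → assoc (proj₁ x) (proj₁ y) (proj₁ z)
        }
      ; identity = (λ x → identityˡ (proj₁ x)) , (λ x → identityʳ (proj₁ x))
      }
    ; inverse = (λ x → inverseˡ (proj₁ x)) , (λ x → inverseʳ (proj₁ x))
    ; ⁻¹-cong = ⁻¹-cong
    }
  }
  where
  open Group G
  open Subgroup H

record Subring (R : CommutativeRing 0ℓ 0ℓ) : Set₁ where
  open CommutativeRing R
  field
    Mem      : Carrier → Set
    mem-resp : ∀ {x y} → x ≈ y → Mem x → Mem y
    0-mem    : Mem 0#
    1-mem    : Mem 1#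
    +-mem    : ∀ {x y} → Mem x → Mem y → Mem (x + y)
    *-mem    : ∀ {x y} → Mem x → Mem y → Mem (x * y)
    neg-mem  : ∀ {x} → Mem x → Mem (- x)

subring : (R : CommutativeRing 0ℓ 0ℓ) → Subring R → CommutativeRing 0ℓ 0ℓ
subring R S = record
  { Carrier = Σ Carrier Mem
  ; _≈_     = λ x y → proj₁ x ≈ proj₁ y
  ; _+_     = λ x y → proj₁ x + proj₁ y , +-mem (proj₂ x) (proj₂ y)
  ; _*_     = λ x y → proj₁ x * proj₁ y , *-mem (proj₂ x) (proj₂ y)
  ; -_      = λ x → - proj₁ x , neg-mem (proj₂ x)
  ; 0#      = 0# , 0-mem
  ; 1#      = 1# , 1-mem
  ; isCommutativeRing = record
    { isRing = record
      { +-isAbelianGroup = record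
        { isGroup = record
          { isMonoid = record
            { isSemigroup = record
              { isMagma = record
                { isEquivalence = record { refl = refl ; sym = sym ; trans = trans }
                ; ∙-cong = +-cong
                }
              ; assoc = λ x y z → +-assoc (proj₁ x) (proj₁ y) (proj₁ z)
              }
            ; identity = (λ x → +-identityˡ (proj₁ x)) , (λ x → +-identityʳ (proj₁ x))
            }
          ; inverse = (λ x → -‿inverseˡ (proj₁ x)) , (λ x → -‿inverseʳ (proj₁ x))
          ; ⁻¹-cong = -‿cong
          }
        ; comm = λ x y → +-comm (proj₁ x) (proj₁ y)
        }
      ; *-cong = *-cong
      ; *-assoc = λ x y z → *-assoc (proj₁ x) (proj₁ y) (proj₁ z)
      ; *-identity = (λ x → *-identityˡ (proj₁ x)) , (λ x → *-identityʳ (proj₁ x))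
      ; distrib = (λ x y z → distribˡ (proj₁ x) (proj₁ y) (proj₁ z))
                , (λ x y z → distribʳ (proj₁ x) (proj₁ y) (proj₁ z))
      }
    ; *-comm = λ x y → *-comm (proj₁ x) (proj₁ y)
    }
  }
  where
  open CommutativeRing R
  open Subring S

IsUnit : (R : CommutativeRing 0ℓ 0ℓ) → CommutativeRing.Carrier R → Set
IsUnit R x = ∃[ y ] x * y ≈ 1#
  where open CommutativeRing R

record Ideal (R : CommutativeRing 0ℓ 0ℓ) : Set₁ where
  open CommutativeRing R
  field
    Mem      : Carrier → Set
    mem-resp : ∀ {x y} → x ≈ y → Mem x → Mem y
    0-mem    : Mem 0#
    +-mem    : ∀ {x y} → Mem x → Mem y → Mem (x + y)
    *-mem    : ∀ r {x} → Mem x → Mem (r * x)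

module _ (R : CommutativeRing 0ℓ 0ℓ) where
  open CommutativeRing R

  -- The product of two ideals: finite sums of products.
  data ProductMem (I J : Carrier → Set) : Carrier → Set where
    nil  : ∀ {z} → z ≈ 0# → ProductMem I J z
    cons : ∀ {x y s z} → I x → J y → ProductMem I J s → z ≈ x * y + s → ProductMem I J z

  PowerMem : Ideal R → ℕ → Carrier → Set
  PowerMem I zero    x = ⊤
  PowerMem I (suc n) x = ProductMem (Ideal.Mem I) (PowerMem I n) x

module _ (R : CommutativeRing 0ℓ 0ℓ) (I : Ideal R) where
  open CommutativeRing R
  open Ideal I
  open RingProperties ring using (-‿+-comm; -1*x≈-x; x[y-z]≈xy-xz; [y-z]x≈yx-zx)
  open GroupProperties +-group using () renaming (⁻¹-involutive to neg-involutive)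
  open CommutativeSemigroupProperties +-commutativeSemigroup using (interchange)

  record Congruent (x y : Carrier) : Set where
    constructor congruent
    field
      difference : Mem (x - y)

  private
    telescope : ∀ x y z → (x - y) + (y - z) ≈ x - z
    telescope x y z =
      trans (+-assoc x (- y) (y - z))
        (+-congˡ (trans (sym (+-assoc (- y) y (- z)))
          (trans (+-congʳ (-‿inverseˡ y)) (+-identityˡ (- z)))))

    neg-mem : ∀ {x} → Mem x → Mem (- x)
    neg-mem {x} m = mem-resp (-1*x≈-x x) (*-mem (- 1#) m)

    ≈⇒ : ∀ {x y} → x ≈ y → Congruent x y
    ≈⇒ {x} {y} e = congruent (mem-resp (sym (trans (+-congʳ e) (-‿inverseʳ y))) 0-mem)

    flip : ∀ {x y} → Mem (x - y) → Mem (y - x)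
    flip {x} {y} m = mem-resp
      (trans (sym (-‿+-comm x (- y)))
        (trans (+-congˡ (neg-involutive y)) (+-comm (- x) y)))
      (neg-mem m)

    +-cong′ : ∀ {x y u v} → Congruent x y → Congruent u v → Congruent (x + u) (y + v)
    +-cong′ {x} {y} {u} {v} (congruent m) (congruent n) = congruent (mem-resp
      (trans (interchange x (- y) u (- v)) (+-congˡ (-‿+-comm y v)))
      (+-mem m n))

    *-cong′ : ∀ {x y u v} → Congruent x y → Congruent u v → Congruent (x * u) (y * v)
    *-cong′ {x} {y} {u} {v} (congruent m) (congruent n) = congruent (mem-resp
      (trans
        (+-cong (trans (*-comm u (x - y)) ([y-z]x≈yx-zx u x y)) (x[y-z]≈xy-xz y u v))
        (telescope (x * u) (y * u) (y * v)))
      (+-mem (*-mem u m) (*-mem y n)))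

  quotientRing : CommutativeRing 0ℓ 0ℓ
  quotientRing = record
    { Carrier = Carrier
    ; _≈_     = Congruent
    ; _+_     = _+_
    ; _*_     = _*_
    ; -_      = -_
    ; 0#      = 0#
    ; 1#      = 1#
    ; isCommutativeRing = record
      { isRing = record
        { +-isAbelianGroup = record
          { isGroup = record
            { isMonoid = record
              { isSemigroup = record
                { isMagma = record
                  { isEquivalence = record
                    { refl  = ≈⇒ refl
                    ; sym   = λ (congruent m) → congruent (flip m)
                    ; trans = λ {x} {y} {z} (congruent m) (congruent n) →
                                congruent (mem-resp (telescope x y z) (+-mem m n))
                    }
                  ; ∙-cong = +-cong′
                  }
                ; assoc = λ x y z → ≈⇒ (+-assoc x y z)
                }
              ; identity = (λ x → ≈⇒ (+-identityˡ x)) , (λ x → ≈⇒ (+-identityʳ x))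
              }
            ; inverse = (λ x → ≈⇒ (-‿inverseˡ x)) , (λ x → ≈⇒ (-‿inverseʳ x))
            ; ⁻¹-cong = λ {x} {y} (congruent m) → congruent (mem-resp (sym (-‿+-comm x (- y))) (neg-mem m))
            }
          ; comm = λ x y → ≈⇒ (+-comm x y)
          }
        ; *-cong = *-cong′
        ; *-assoc = λ x y z → ≈⇒ (*-assoc x y z)
        ; *-identity = (λ x → ≈⇒ (*-identityˡ x)) , (λ x → ≈⇒ (*-identityʳ x))
        ; distrib = (λ x y z → ≈⇒ (distribˡ x y z)) , (λ x y z → ≈⇒ (distribʳ x y z))
        }
      ; *-comm = λ x y → ≈⇒ (*-comm x y)
      }
    }

record Mat (A : Set) : Set where
  constructor mat
  field
    e₁₁ e₁₂ e₂₁ e₂₂ : A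

module Matrices (R : CommutativeRing 0ℓ 0ℓ) where
  open CommutativeRing R

  infix  4 _≈ᴹ_
  infixl 6 _+ᴹ_
  infixl 7 _*ᴹ_ _·ᴹ_

  _≈ᴹ_ : Rel (Mat Carrier) 0ℓ
  mat a b c d ≈ᴹ mat a′ b′ c′ d′ = (a ≈ a′) × (b ≈ b′) × (c ≈ c′) × (d ≈ d′)

  _+ᴹ_ : Op₂ (Mat Carrier)
  mat a b c d +ᴹ mat a′ b′ c′ d′ = mat (a + a′) (b + b′) (c + c′) (d + d′)

  _*ᴹ_ : Op₂ (Mat Carrier)
  mat a b c d *ᴹ mat a′ b′ c′ d′ =
    mat (a * a′ + b * c′) (a * b′ + b * d′) (c * a′ + d * c′) (c * b′ + d * d′)

  _·ᴹ_ : Carrier → Mat Carrier → Mat Carrier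
  r ·ᴹ mat a b c d = mat (r * a) (r * b) (r * c) (r * d)

  0ᴹ 1ᴹ : Mat Carrier
  0ᴹ = mat 0# 0# 0# 0#
  1ᴹ = mat 1# 0# 0# 1#

  det : Mat Carrier → Carrier
  det (mat a b c d) = a * d - b * c

  rawMonoidᴹ : RawMonoid 0ℓ 0ℓ
  rawMonoidᴹ = record { _≈_ = _≈ᴹ_ ; _∙_ = _*ᴹ_ ; ε = 1ᴹ }

  IsNilpotent : Mat Carrier → Set
  IsNilpotent N = ∃[ n ] RawMonoidDefs._×_ rawMonoidᴹ n N ≈ᴹ 0ᴹ

  -- The exponential of a nilpotent matrix over a field: such a 2 × 2 matrix squares to
  -- zero, so the series stops after the linear term.
  expᴹ : Mat Carrier → Mat Carrier
  expᴹ N = 1ᴹ +ᴹ N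

  record Conjugator : Set where
    field
      P P⁻¹    : Mat Carrier
      inverseˡ : P⁻¹ *ᴹ P ≈ᴹ 1ᴹ
      inverseʳ : P *ᴹ P⁻¹ ≈ᴹ 1ᴹ

  Isomorphic : {G : Set} → (G → Mat Carrier) → (G → Mat Carrier) → Set
  Isomorphic ρ ρ′ = Σ[ C ∈ Conjugator ] (∀ g → Conjugator.P C *ᴹ ρ g ≈ᴹ ρ′ g *ᴹ Conjugator.P C)

record Field : Set₁ where
  field
    commutativeRing : CommutativeRing 0ℓ 0ℓ
  open CommutativeRing commutativeRing public
  infix 8 _⁻¹
  infixl 7 _/_
  field
    _⁻¹     : Carrier → Carrier
    ⁻¹-cong : ∀ {x y} → x ≈ y → x ⁻¹ ≈ y ⁻¹
    0⁻¹≈0   : 0# ⁻¹ ≈ 0#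
    *-⁻¹    : ∀ x → x ≉ 0# → x * x ⁻¹ ≈ 1#
    1≉0     : 1# ≉ 0#

  _/_ : Carrier → Carrier → Carrier
  x / y = x * y ⁻¹

  *-rawGroup : RawGroup 0ℓ 0ℓ
  *-rawGroup = record { _≈_ = _≈_ ; _∙_ = _*_ ; ε = 1# ; _⁻¹ = _⁻¹ }

  open Exp semiring using (_^_) public
  -- Value at x of the monic polynomial c₀ + c₁X + … + cₙ₋₁Xⁿ⁻¹ + Xⁿ with list of lower
  -- coefficients c₀ ∷ c₁ ∷ … ∷ cₙ₋₁ ∷ [].
  monicAt : List Carrier → Carrier → Carrier
  monicAt []       x = 1#
  monicAt (c ∷ cs) x = c + x * monicAt cs x

  open RawSemiringDefs (Semiring.rawSemiring semiring) using (sum) renaming (_×_ to _×ₙ_) public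

module _ {Γ : Set} (_+_ : Op₂ Γ) where

  lift⁺ : Op₂ (Γ ⁺)
  lift⁺ [ a ] [ b ] = [ a + b ]
  lift⁺ [ _ ] ⊤⁺    = ⊤⁺
  lift⁺ ⊤⁺    _     = ⊤⁺

-- ⊤⁺ plays the role of the valuation ∞.
record IsValuation (R : CommutativeRing 0ℓ 0ℓ) {Γ : Set} (_+Γ_ : Op₂ Γ) (_≤Γ_ : Rel Γ 0ℓ)
                   (v : CommutativeRing.Carrier R → Γ ⁺) : Set where
  open CommutativeRing R
  field
    v-cong : ∀ {x y} → x ≈ y → v x ≡ v y
    v-∞    : ∀ x → v x ≡ ⊤⁺ ⇔ x ≈ 0#
    v-*    : ∀ x y → v (x * y) ≡ lift⁺ _+Γ_ (v x) (v y)
    v-+    : ∀ γ x y → ≤⁺-over _≤Γ_ γ (v x) → ≤⁺-over _≤Γ_ γ (v y) → ≤⁺-over _≤Γ_ γ (v (x + y))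

record Subfield (E : Field) : Set₁ where
  open Field E
  field
    isSubring : Subring commutativeRing
  open Subring isSubring public
  field
    ⁻¹-mem : ∀ {x} → Mem x → Mem (x ⁻¹)

subfield : (E : Field) → Subfield E → Field
subfield E L = record
  { commutativeRing = subring commutativeRing isSubring
  ; _⁻¹     = λ x → proj₁ x ⁻¹ , ⁻¹-mem (proj₂ x)
  ; ⁻¹-cong = ⁻¹-cong
  ; 0⁻¹≈0   = 0⁻¹≈0
  ; *-⁻¹    = λ x → *-⁻¹ (proj₁ x)
  ; 1≉0     = 1≉0
  }
  where
  open Field E
  open Subfield L

wholeField : (E : Field) → Subfield E
wholeField E = record
  { isSubring = record
    { Mem      = λ _ → ⊤
    ; mem-resp = λ _ _ → tt
    ; 0-mem    = tt
    ; 1-mem    = tt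
    ; +-mem    = λ _ _ → tt
    ; *-mem    = λ _ _ → tt
    ; neg-mem  = λ _ → tt
    }
  ; ⁻¹-mem = λ _ → tt
  }

infix 4 _≡_[mod_]

record _≡_[mod_] (x y m : ℤ) : Set where
  constructor by
  field
    divides : m ∣ℤ (x ℤ.- y)

-- The inverse limit of the rings ℤ/pⁿ, each residue being given by a representative in ℤ.
record PAdicInt (p : ℕ) : Set where
  field
    approx   : ℕ → ℤ
    coherent : ∀ n → approx (suc n) ≡ approx n [mod + (p ℕ.^ n) ]

module _ (p : ℕ) where
  open PAdicInt

  private
    C : Set
    C = PAdicInt p

    infix 4 _≈_
    _≈_ : Rel C 0ℓ
    a ≈ b = ∀ n → approx a n ≡ approx b n [mod + (p ℕ.^ n) ]

    zero-diff : ∀ {d x y} → x ≡ y → x ≡ y [mod d ]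
    zero-diff {x = x} ≡.refl = by (dividesℤ 0ℤ (ℤ.+-inverseʳ x))

    pw : ∀ a b → (∀ n → approx a n ≡ approx b n) → a ≈ b
    pw a b e n = zero-diff (e n)

    +-diff : ∀ {d x y u v} → x ≡ y [mod d ] → u ≡ v [mod d ] → x ℤ.+ u ≡ y ℤ.+ v [mod d ]
    +-diff {d} {x} {y} {u} {v} (by m) (by n) = by (≡.subst (d ∣ℤ_) (eq x y u v) (∣m∣n⇒∣m+n m n))
      where
      eq : ∀ x y u v → (x ℤ.- y) ℤ.+ (u ℤ.- v) ≡ (x ℤ.+ u) ℤ.- (y ℤ.+ v)
      eq = solve-∀

    *-diff : ∀ {d x y u v} → x ≡ y [mod d ] → u ≡ v [mod d ] → x ℤ.* u ≡ y ℤ.* v [mod d ]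
    *-diff {d} {x} {y} {u} {v} (by m) (by n) =
      by (≡.subst (d ∣ℤ_) (eq x y u v) (∣m∣n⇒∣m+n (∣m⇒∣m*n u m) (∣n⇒∣m*n y n)))
      where
      eq : ∀ x y u v → (x ℤ.- y) ℤ.* u ℤ.+ y ℤ.* (u ℤ.- v) ≡ (x ℤ.* u) ℤ.- (y ℤ.* v)
      eq = solve-∀

    neg-diff : ∀ {d x y} → x ≡ y [mod d ] → ℤ.- x ≡ ℤ.- y [mod d ]
    neg-diff {d} {x} {y} (by m) = by (≡.subst (d ∣ℤ_) (eq x y) (∣m⇒∣-m m))
      where
      eq : ∀ x y → ℤ.- (x ℤ.- y) ≡ (ℤ.- x) ℤ.- (ℤ.- y)
      eq = solve-∀

    sym-diff : ∀ {d x y} → x ≡ y [mod d ] → y ≡ x [mod d ]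
    sym-diff {d} {x} {y} (by m) = by (≡.subst (d ∣ℤ_) (eq x y) (∣m⇒∣-m m))
      where
      eq : ∀ x y → ℤ.- (x ℤ.- y) ≡ y ℤ.- x
      eq = solve-∀

    trans-diff : ∀ {d x y z} → x ≡ y [mod d ] → y ≡ z [mod d ] → x ≡ z [mod d ]
    trans-diff {d} {x} {y} {z} (by m) (by n) = by (≡.subst (d ∣ℤ_) (eq x y z) (∣m∣n⇒∣m+n m n))
      where
      eq : ∀ x y z → (x ℤ.- y) ℤ.+ (y ℤ.- z) ≡ x ℤ.- z
      eq = solve-∀

    const : ℤ → C
    const z = record { approx = λ _ → z ; coherent = λ _ → zero-diff ≡.refl }

    infixl 6 _⊕_
    infixl 7 _⊗_
    _⊕_ _⊗_ : Op₂ C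
    a ⊕ b = record { approx   = λ n → approx a n ℤ.+ approx b n
                   ; coherent = λ n → +-diff (coherent a n) (coherent b n) }
    a ⊗ b = record { approx   = λ n → approx a n ℤ.* approx b n
                   ; coherent = λ n → *-diff (coherent a n) (coherent b n) }

    ⊖_ : C → C
    ⊖ a = record { approx = λ n → ℤ.- approx a n ; coherent = λ n → neg-diff (coherent a n) }

  ℤ-adic : CommutativeRing 0ℓ 0ℓ
  ℤ-adic = record
    { Carrier = C
    ; _≈_ = _≈_
    ; _+_ = _⊕_
    ; _*_ = _⊗_
    ; -_  = ⊖_
    ; 0#  = const 0ℤ
    ; 1#  = const 1ℤ
    ; isCommutativeRing = record
      { isRing = record
        { +-isAbelianGroup = record
          { isGroup = record
            { isMonoid = record
              { isSemigroup = record
                { isMagma = record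
                  { isEquivalence = record
                    { refl  = λ {a} → pw a a (λ _ → ≡.refl)
                    ; sym   = λ m n → sym-diff (m n)
                    ; trans = λ m m′ n → trans-diff (m n) (m′ n)
                    }
                  ; ∙-cong = λ m m′ n → +-diff (m n) (m′ n)
                  }
                ; assoc = λ a b c → pw ((a ⊕ b) ⊕ c) (a ⊕ (b ⊕ c))
                            (λ n → ℤ.+-assoc (approx a n) (approx b n) (approx c n))
                }
              ; identity = (λ a → pw (const 0ℤ ⊕ a) a (λ n → ℤ.+-identityˡ (approx a n)))
                         , (λ a → pw (a ⊕ const 0ℤ) a (λ n → ℤ.+-identityʳ (approx a n)))
              }
            ; inverse = (λ a → pw (⊖ a ⊕ a) (const 0ℤ) (λ n → ℤ.+-inverseˡ (approx a n)))
                      , (λ a → pw (a ⊕ ⊖ a) (const 0ℤ) (λ n → ℤ.+-inverseʳ (approx a n)))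
            ; ⁻¹-cong = λ m n → neg-diff (m n)
            }
          ; comm = λ a b → pw (a ⊕ b) (b ⊕ a) (λ n → ℤ.+-comm (approx a n) (approx b n))
          }
        ; *-cong = λ m m′ n → *-diff (m n) (m′ n)
        ; *-assoc = λ a b c → pw ((a ⊗ b) ⊗ c) (a ⊗ (b ⊗ c))
                      (λ n → ℤ.*-assoc (approx a n) (approx b n) (approx c n))
        ; *-identity = (λ a → pw (const 1ℤ ⊗ a) a (λ n → ℤ.*-identityˡ (approx a n)))
                     , (λ a → pw (a ⊗ const 1ℤ) a (λ n → ℤ.*-identityʳ (approx a n)))
        ; distrib = (λ a b c → pw (a ⊗ (b ⊕ c)) ((a ⊗ b) ⊕ (a ⊗ c))
                      (λ n → ℤ.*-distribˡ-+ (approx a n) (approx b n) (approx c n)))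
                  , (λ a b c → pw ((b ⊕ c) ⊗ a) ((b ⊗ a) ⊕ (c ⊗ a))
                      (λ n → ℤ.*-distribʳ-+ (approx a n) (approx b n) (approx c n)))
        }
      ; *-comm = λ a b → pw (a ⊗ b) (b ⊗ a) (λ n → ℤ.*-comm (approx a n) (approx b n))
      }
    }

record AlgebraicClosure (p : ℕ) : Set₁ where
  field
    underlying : Field
  open Field underlying public

  field
    ι     : PAdicInt p → Carrier
    ι-mono : IsRingMonomorphism (CommutativeRing.rawRing (ℤ-adic p)) rawRing ι

  -- ℚₚ is the fraction field ℤₚ[1/p] of the image of ℤₚ.
  Isℚₚ : Carrier → Set
  Isℚₚ x = ∃[ k ] ∃[ a ] (p ×ₙ 1#) ^ k * x ≈ ι a

  IsIntegral : Carrier → Set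
  IsIntegral x = ∃[ cs ] monicAt (map ι cs) x ≈ 0#

  field
    algebraic           : ∀ x → ∃[ cs ] All Isℚₚ cs × monicAt cs x ≈ 0#
    algebraicallyClosed : ∀ c cs → ∃[ x ] monicAt (c ∷ cs) x ≈ 0#

    -- The unique extension of the p-adic valuation of ℚₚ.
    val             : Carrier → ℚ ⁺
    val-isValuation : IsValuation commutativeRing ℚ._+_ ℚ._≤_ val
    val-p           : val (p ×ₙ 1#) ≡ [ 1ℚ ]
    val-integral    : ∀ x → ≤⁺-over ℚ._≤_ [ 0ℚ ] (val x) ⇔ IsIntegral x

module _ {p : ℕ} (E : AlgebraicClosure p) where
  open AlgebraicClosure E
  open IsValuation val-isValuation
  open RingProperties ring using (-1*x≈-x)

  private
    infix 4 _≤⁺_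
    _≤⁺_ : Rel (ℚ ⁺) 0ℓ
    _≤⁺_ = ≤⁺-over ℚ._≤_

    integral : ∀ x → [ 0ℚ ] ≤⁺ val x → IsIntegral x
    integral x = Equivalence.to (val-integral x)

    nonneg : ∀ x → IsIntegral x → [ 0ℚ ] ≤⁺ val x
    nonneg x = Equivalence.from (val-integral x)

    +ℚ-idem : ∀ a → a ≡ a ℚ.+ a → a ≡ 0ℚ
    +ℚ-idem a e = identityˡ-unique a a (≡.sym e)
      where open GroupProperties ℚ.+-0-group using (identityˡ-unique)

    val-1 : val 1# ≡ [ 0ℚ ]
    val-1 with val 1# in eq
             | ≡.trans (≡.sym (v-cong (*-identityˡ 1#))) (v-* 1# 1#)
    ... | ⊤⁺    | _ = contradiction (Equivalence.to (v-∞ 1#) eq) 1≉0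
    ... | [ a ] | e = ≡.cong [_] (+ℚ-idem a ([]-injective e))
    integral-resp : ∀ {x y} → x ≈ y → IsIntegral x → IsIntegral y
    integral-resp e (cs , r) = integral _ (≡.subst ([ 0ℚ ] ≤⁺_) (v-cong e) (nonneg _ (cs , r)))

    integral-0 : IsIntegral 0#
    integral-0 = integral 0#
      (≡.subst ([ 0ℚ ] ≤⁺_) (≡.sym (Equivalence.from (v-∞ 0#) refl)) ([ 0ℚ ] ≤⊤⁺))

    integral-1 : IsIntegral 1#
    integral-1 = integral 1# (≡.subst ([ 0ℚ ] ≤⁺_) (≡.sym val-1) [ ℚ.≤-refl ])

    integral-+ : ∀ {x y} → IsIntegral x → IsIntegral y → IsIntegral (x + y)
    integral-+ {x} {y} i j = integral (x + y) (v-+ [ 0ℚ ] x y (nonneg x i) (nonneg y j))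

    nonneg-lift : ∀ s t → [ 0ℚ ] ≤⁺ s → [ 0ℚ ] ≤⁺ t → [ 0ℚ ] ≤⁺ lift⁺ ℚ._+_ s t
    nonneg-lift [ a ] [ b ] [ m ] [ n ] = [ ℚ.+-mono-≤ m n ]
    nonneg-lift [ a ] ⊤⁺    _     _     = [ 0ℚ ] ≤⊤⁺
    nonneg-lift ⊤⁺    _     _     _     = [ 0ℚ ] ≤⊤⁺

    integral-* : ∀ {x y} → IsIntegral x → IsIntegral y → IsIntegral (x * y)
    integral-* {x} {y} i j = integral (x * y)
      (≡.subst ([ 0ℚ ] ≤⁺_) (≡.sym (v-* x y))
        (nonneg-lift (val x) (val y) (nonneg x i) (nonneg y j)))

    integral-neg1 : IsIntegral (- 1#)
    integral-neg1 = (CommutativeRing.1# (ℤ-adic p) ∷ []) ,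
      trans (+-cong (IsRingMonomorphism.1#-homo ι-mono) (*-identityʳ (- 1#))) (-‿inverseʳ 1#)

    integral-neg : ∀ {x} → IsIntegral x → IsIntegral (- x)
    integral-neg {x} i = integral-resp (-1*x≈-x x) (integral-* integral-neg1 i)

  -- The integral closure of ℤₚ in L.
  integers : Subfield underlying → Subring commutativeRing
  integers L = record
    { Mem      = λ x → Mem x × IsIntegral x
    ; mem-resp = λ e m → mem-resp e (proj₁ m) , integral-resp e (proj₂ m)
    ; 0-mem    = 0-mem , integral-0
    ; 1-mem    = 1-mem , integral-1
    ; +-mem    = λ m n → +-mem (proj₁ m) (proj₁ n) , integral-+ (proj₂ m) (proj₂ n)
    ; *-mem    = λ m n → *-mem (proj₁ m) (proj₁ n) , integral-* (proj₂ m) (proj₂ n)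
    ; neg-mem  = λ m → neg-mem (proj₁ m) , integral-neg (proj₂ m)
    }
    where open Subfield L

  𝓞 : Subfield underlying → CommutativeRing 0ℓ 0ℓ
  𝓞 L = subring commutativeRing (integers L)

  private
    lift-nonneg-zero : ∀ s t → lift⁺ ℚ._+_ s t ≡ [ 0ℚ ] → [ 0ℚ ] ≤⁺ s → [ 0ℚ ] ≤⁺ t → s ≡ [ 0ℚ ]
    lift-nonneg-zero [ a ] [ b ] e [ m ] [ n ] = ≡.cong [_] (ℚ.≤-antisym a≤0 m)
      where
      a≤0 : a ℚ.≤ 0ℚ
      a≤0 = ≡.subst₂ ℚ._≤_ (ℚ.+-identityʳ a) ([]-injective e) (ℚ.+-monoʳ-≤ a n)
    lift-nonneg-zero [ a ] ⊤⁺    () _ _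
    lift-nonneg-zero ⊤⁺    _     () _ _

    zero-lift : ∀ t → lift⁺ ℚ._+_ [ 0ℚ ] t ≡ [ 0ℚ ] → t ≡ [ 0ℚ ]
    zero-lift [ b ] e = ≡.trans (≡.cong [_] (≡.sym (ℚ.+-identityˡ b))) e
    zero-lift ⊤⁺    ()

    unit⇒val0 : ∀ L x → IsUnit (𝓞 L) x → val (proj₁ x) ≡ [ 0ℚ ]
    unit⇒val0 L (x , _ , i) ((y , _ , j) , e) = lift-nonneg-zero (val x) (val y)
      (≡.trans (≡.sym (v-* x y)) (≡.trans (v-cong e) val-1)) (nonneg x i) (nonneg y j)

    val0⇒unit : ∀ L x → val (proj₁ x) ≡ [ 0ℚ ] → IsUnit (𝓞 L) x
    val0⇒unit L (x , m , i) z = (x ⁻¹ , Subfield.⁻¹-mem L m , j) , inv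
      where
      x≉0 : x ≉ 0#
      x≉0 e with ≡.trans (≡.sym z) (Equivalence.from (v-∞ x) e)
      ... | ()

      inv : x * x ⁻¹ ≈ 1#
      inv = *-⁻¹ x x≉0

      val-inv : val (x ⁻¹) ≡ [ 0ℚ ]
      val-inv = zero-lift (val (x ⁻¹))
        (≡.trans (≡.cong (λ s → lift⁺ ℚ._+_ s (val (x ⁻¹))) (≡.sym z))
          (≡.trans (≡.sym (v-* x (x ⁻¹))) (≡.trans (v-cong inv) val-1)))

      j : IsIntegral (x ⁻¹)
      j = integral (x ⁻¹) (≡.subst ([ 0ℚ ] ≤⁺_) (≡.sym val-inv) [ ℚ.≤-refl ])

    ≤0⇒≡0 : ∀ s → [ 0ℚ ] ≤⁺ s → s ≤⁺ [ 0ℚ ] → s ≡ [ 0ℚ ]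
    ≤0⇒≡0 [ a ] [ m ] [ n ] = ≡.cong [_] (ℚ.≤-antisym n m)

    ≤⁺-total : ∀ s t → s ≤⁺ t ⊎ t ≤⁺ s
    ≤⁺-total s     ⊤⁺    = inj₁ (s ≤⊤⁺)
    ≤⁺-total ⊤⁺    t     = inj₂ (t ≤⊤⁺)
    ≤⁺-total [ a ] [ b ] with ℚ.≤-total a b
    ... | inj₁ m = inj₁ [ m ]
    ... | inj₂ n = inj₂ [ n ]

    ≤⁺-refl : ∀ s → s ≤⁺ s
    ≤⁺-refl [ a ] = [ ℚ.≤-refl ]
    ≤⁺-refl ⊤⁺    = ⊤⁺ ≤⊤⁺

    nonunit-+ : ∀ L (x y : CommutativeRing.Carrier (𝓞 L)) →
                ¬ IsUnit (𝓞 L) x → ¬ IsUnit (𝓞 L) y → ¬ IsUnit (𝓞 L) (CommutativeRing._+_ (𝓞 L) x y)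
    nonunit-+ L x@(x₀ , _ , i) y@(y₀ , _ , j) nx ny u = case (≤⁺-total (val x₀) (val y₀))
      where
      val-sum : val (x₀ + y₀) ≡ [ 0ℚ ]
      val-sum = unit⇒val0 L (CommutativeRing._+_ (𝓞 L) x y) u

      small : ∀ s → s ≤⁺ val x₀ → s ≤⁺ val y₀ → s ≤⁺ [ 0ℚ ]
      small s a b = ≡.subst (s ≤⁺_) val-sum (v-+ s x₀ y₀ a b)

      case : val x₀ ≤⁺ val y₀ ⊎ val y₀ ≤⁺ val x₀ → _
      case (inj₁ h) = nx (val0⇒unit L x
        (≤0⇒≡0 (val x₀) (nonneg x₀ i) (small (val x₀) (≤⁺-refl (val x₀)) h)))
      case (inj₂ h) = ny (val0⇒unit L y
        (≤0⇒≡0 (val y₀) (nonneg y₀ j) (small (val y₀) h (≤⁺-refl (val y₀)))))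

  -- The non-units of the local ring 𝓞 L.
  maximalIdeal : (L : Subfield underlying) → Ideal (𝓞 L)
  maximalIdeal L = record
    { Mem      = λ x → ¬ IsUnit (𝓞 L) x
    ; mem-resp = λ e n u → n (proj₁ u , trans (*-congʳ e) (proj₂ u))
    ; 0-mem    = λ u → 1≉0 (trans (sym (proj₂ u)) (zeroˡ (proj₁ (proj₁ u))))
    ; +-mem    = λ {x} {y} → nonunit-+ L x y
    ; *-mem    = λ r {x} n u → n
        ( CommutativeRing._*_ (𝓞 L) r (proj₁ u)
        , trans (sym (*-assoc (proj₁ x) (proj₁ r) (proj₁ (proj₁ u))))
                (trans (*-congʳ (*-comm (proj₁ x) (proj₁ r))) (proj₂ u)) )
    }

  residueField : Subfield underlying → CommutativeRing 0ℓ 0ℓ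
  residueField L = quotientRing (𝓞 L) (maximalIdeal L)

  HasResidueOrder : Subfield underlying → ℕ → Set
  HasResidueOrder L q = Bijection (≡.setoid (Fin q)) (CommutativeRing.setoid (residueField L))

  record IsFiniteExtension (L : Subfield underlying) : Set where
    open Subfield L
    field
      ℚₚ⊆       : ∀ {x} → Isℚₚ x → Mem x
      dim       : ℕ
      basis     : Fin dim → Carrier
      basis-mem : ∀ j → Mem (basis j)
      spans     : ∀ x → Mem x → Σ[ c ∈ (Fin dim → Carrier) ]
                    (∀ j → Isℚₚ (c j)) × x ≈ sum (λ j → c j * basis j)

  record IsNormalizedValuation (L : Subfield underlying)
         (v : Field.Carrier (subfield underlying L) → ℤ ⁺) : Set where
    field
      isValuation : IsValuation (Field.commutativeRing (subfield underlying L)) ℤ._+_ ℤ._≤_ v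
      uniformizer : ∃[ π ] v π ≡ [ 1ℤ ]
      integers⇔   : ∀ x → ≤⁺-over ℤ._≤_ [ 0ℤ ] (v x) ⇔ IsIntegral (proj₁ x)

  -- x ≡ y modulo pⁿ times the integers of E: the basic neighbourhoods of the p-adic topology.
  Close : ℕ → Rel Carrier 0ℓ
  Close n x y = ∃[ z ] IsIntegral z × x - y ≈ (p ×ₙ 1#) ^ n * z

module Weil {p : ℕ} (F̄ : AlgebraicClosure p) (F : Subfield (AlgebraicClosure.underlying F̄))
            (F-finite : IsFiniteExtension F̄ F) (q : ℕ) where
  open AlgebraicClosure F̄
  open IsFiniteExtension F-finite using (ℚₚ⊆)

  record Automorphism : Set where
    field
      to from   : Carrier → Carrier
      to-hom    : IsRingHomomorphism rawRing rawRing to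
      from-hom  : IsRingHomomorphism rawRing rawRing from
      to∘from   : ∀ x → to (from x) ≈ x
      from∘to   : ∀ x → from (to x) ≈ x
      fixes     : ∀ {x} → Subfield.Mem F x → to x ≈ x
  open Automorphism

  private
    module H (σ : Automorphism) = IsRingHomomorphism (to-hom σ)
    module H⁻¹ (σ : Automorphism) = IsRingHomomorphism (from-hom σ)

  infixl 7 _∙_
  _∙_ : Op₂ Automorphism
  σ ∙ τ = record
    { to       = to σ ∘ to τ
    ; from     = from τ ∘ from σ
    ; to-hom   = Composition.isRingHomomorphism trans (to-hom τ) (to-hom σ)
    ; from-hom = Composition.isRingHomomorphism trans (from-hom σ) (from-hom τ)
    ; to∘from  = λ x → trans (H.⟦⟧-cong σ (to∘from τ (from σ x))) (to∘from σ x)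
    ; from∘to  = λ x → trans (H⁻¹.⟦⟧-cong τ (from∘to σ (to τ x))) (from∘to τ x)
    ; fixes    = λ m → trans (H.⟦⟧-cong σ (fixes τ m)) (fixes σ m)
    }

  1ᴬ : Automorphism
  1ᴬ = record
    { to       = λ x → x
    ; from     = λ x → x
    ; to-hom   = Identity.isRingHomomorphism rawRing refl
    ; from-hom = Identity.isRingHomomorphism rawRing refl
    ; to∘from  = λ _ → refl
    ; from∘to  = λ _ → refl
    ; fixes    = λ _ → refl
    }

  inv : Automorphism → Automorphism
  inv σ = record
    { to       = from σ
    ; from     = to σ
    ; to-hom   = from-hom σ
    ; from-hom = to-hom σ
    ; to∘from  = from∘to σ
    ; from∘to  = to∘from σ
    ; fixes    = λ {x} m → trans (H⁻¹.⟦⟧-cong σ (sym (fixes σ m))) (from∘to σ x)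
    }

  galoisGroup : Group 0ℓ 0ℓ
  galoisGroup = record
    { Carrier = Automorphism
    ; _≈_     = λ σ τ → ∀ x → to σ x ≈ to τ x
    ; _∙_     = _∙_
    ; ε       = 1ᴬ
    ; _⁻¹     = inv
    ; isGroup = record
      { isMonoid = record
        { isSemigroup = record
          { isMagma = record
            { isEquivalence = record
              { refl  = λ _ → refl
              ; sym   = λ e x → sym (e x)
              ; trans = λ e f x → trans (e x) (f x)
              }
            ; ∙-cong = λ {σ} {σ′} {τ} {τ′} e f x → trans (H.⟦⟧-cong σ (f x)) (e (to τ′ x))
            }
          ; assoc = λ _ _ _ _ → refl
          }
        ; identity = (λ _ _ → refl) , (λ _ _ → refl)
        }
      ; inverse = from∘to , to∘from
      ; ⁻¹-cong = λ {σ} {τ} e x → trans (sym (from∘to τ (from σ x)))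
                    (H⁻¹.⟦⟧-cong τ (trans (sym (e (from σ x))) (to∘from σ x)))
      }
    }

  𝕆 : CommutativeRing 0ℓ 0ℓ
  𝕆 = 𝓞 F̄ (wholeField underlying)

  k̄ : CommutativeRing 0ℓ 0ℓ
  k̄ = residueField F̄ (wholeField underlying)

  module 𝕆 = CommutativeRing 𝕆
  module k̄ = CommutativeRing k̄
  open Exp k̄.semiring using () renaming (_^_ to _^ᵏ_; ^-congˡ to ^ᵏ-congˡ; ^-assocʳ to ^ᵏ-assocʳ)

  private
    fixes-ι : ∀ σ a → to σ (ι a) ≈ ι a
    fixes-ι σ a = fixes σ (ℚₚ⊆ (0 , a , *-identityˡ (ι a)))

    to-monicAt : ∀ σ cs x → to σ (monicAt (map ι cs) x) ≈ monicAt (map ι cs) (to σ x)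
    to-monicAt σ []       x = H.1#-homo σ
    to-monicAt σ (c ∷ cs) x =
      trans (H.+-homo σ (ι c) (x * monicAt (map ι cs) x))
        (+-cong (fixes-ι σ c)
          (trans (H.*-homo σ x (monicAt (map ι cs) x)) (*-congˡ (to-monicAt σ cs x))))

    to-integral : ∀ σ {x} → IsIntegral x → IsIntegral (to σ x)
    to-integral σ {x} (cs , e) = cs ,
      trans (sym (to-monicAt σ cs x)) (trans (H.⟦⟧-cong σ e) (H.0#-homo σ))

  -- The action on the integers of F̄; these also carry the residue field of F̄.
  act : Automorphism → 𝕆.Carrier → 𝕆.Carrier
  act σ (x , _ , i) = to σ x , tt , to-integral σ i

  -- σ acts on the residue field of F̄ as x ↦ x^(qⁿ).
  ActsAsFrobenius^ : ℕ → Automorphism → Set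
  ActsAsFrobenius^ n σ = ∀ x → act σ x k̄.≈ x ^ᵏ (q ℕ.^ n)

  -- σ acts on the residue field of F̄ as the inverse of x ↦ x^q.  This is the normalization for
  -- which ω(Φ) = q⁻¹ is compatible with t(gτg⁻¹) = ω(g)t(τ).
  IsGeometricFrobenius : Automorphism → Set
  IsGeometricFrobenius σ = ActsAsFrobenius^ 1 (inv σ)

  ActsTrivially : Automorphism → Set
  ActsTrivially σ = ∀ x → act σ x k̄.≈ x

  -- σ acts on the residue field of F̄ as an integral power of x ↦ x^q.
  InWeil : Automorphism → Set
  InWeil σ = ∃[ n ] (ActsAsFrobenius^ n σ ⊎ ActsAsFrobenius^ n (inv σ))

  𝕆⇒k̄ : ∀ {x y} → x 𝕆.≈ y → x k̄.≈ y
  𝕆⇒k̄ {x} {y} e = congruent λ u → Congruent.difference (k̄.refl {x})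
    (proj₁ u , trans (*-congʳ (+-congˡ (-‿cong e))) (proj₂ u))

  act-cong : ∀ σ {x y} → x k̄.≈ y → act σ x k̄.≈ act σ y
  act-cong σ {x} {y} (congruent n) = congruent λ ((z , _ , i) , e) →
    n ((from σ z , tt , to-integral (inv σ) i) , (begin
      (x₀ - y₀) * from σ z
        ≈⟨ *-congʳ (+-cong (from∘to σ x₀) (-‿cong (from∘to σ y₀))) ⟨
      (from σ (to σ x₀) - from σ (to σ y₀)) * from σ z
        ≈⟨ *-congʳ (+-congˡ (H⁻¹.-‿homo σ (to σ y₀))) ⟨
      (from σ (to σ x₀) + from σ (- to σ y₀)) * from σ z
        ≈⟨ *-congʳ (H⁻¹.+-homo σ (to σ x₀) (- to σ y₀)) ⟨
      from σ (to σ x₀ - to σ y₀) * from σ z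
        ≈⟨ H⁻¹.*-homo σ (to σ x₀ - to σ y₀) z ⟨
      from σ ((to σ x₀ - to σ y₀) * z)
        ≈⟨ H⁻¹.⟦⟧-cong σ e ⟩
      from σ 1#
        ≈⟨ H⁻¹.1#-homo σ ⟩
      1# ∎))
    where
    open import Relation.Binary.Reasoning.Setoid setoid
    x₀ y₀ : Carrier
    x₀ = proj₁ x
    y₀ = proj₁ y

  act-^ : ∀ σ x n → act σ (x ^ᵏ n) k̄.≈ act σ x ^ᵏ n
  act-^ σ x zero    = 𝕆⇒k̄ (H.1#-homo σ)
  act-^ σ x (suc n) = k̄.trans (𝕆⇒k̄ (H.*-homo σ _ _)) (k̄.*-congˡ {act σ x} (act-^ σ x n))

  act-resp : ∀ {σ τ} → (∀ x → to σ x ≈ to τ x) → ∀ x → act τ x k̄.≈ act σ x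
  act-resp e x = 𝕆⇒k̄ (sym (e (proj₁ x)))

  open import Relation.Binary.Reasoning.Setoid k̄.setoid

  ^ᵏ-+ : ∀ x m n → (x ^ᵏ (q ℕ.^ m)) ^ᵏ (q ℕ.^ n) k̄.≈ x ^ᵏ (q ℕ.^ (m ℕ.+ n))
  ^ᵏ-+ x m n = k̄.trans (^ᵏ-assocʳ x (q ℕ.^ m) (q ℕ.^ n))
    (k̄.reflexive (≡.cong (x ^ᵏ_) (≡.sym (ℕ.^-distribˡ-+-* q m n))))

  frob-comp : ∀ m n {σ τ} → ActsAsFrobenius^ m σ → ActsAsFrobenius^ n τ →
              ActsAsFrobenius^ (m ℕ.+ n) (σ ∙ τ)
  frob-comp m n {σ} {τ} f g x = begin
    act (σ ∙ τ) x                   ≈⟨ 𝕆⇒k̄ refl ⟩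
    act σ (act τ x)                 ≈⟨ act-cong σ (g x) ⟩
    act σ (x ^ᵏ (q ℕ.^ n))          ≈⟨ act-^ σ x (q ℕ.^ n) ⟩
    act σ x ^ᵏ (q ℕ.^ n)            ≈⟨ ^ᵏ-congˡ (q ℕ.^ n) (f x) ⟩
    (x ^ᵏ (q ℕ.^ m)) ^ᵏ (q ℕ.^ n)   ≈⟨ ^ᵏ-+ x m n ⟩
    x ^ᵏ (q ℕ.^ (m ℕ.+ n))          ∎

  frob-cancelʳ : ∀ m d {σ τ} → ActsAsFrobenius^ (m ℕ.+ d) σ → ActsAsFrobenius^ m (inv τ) →
                 ActsAsFrobenius^ d (σ ∙ τ)
  frob-cancelʳ m d {σ} {τ} f g x = begin
    act (σ ∙ τ) x                         ≈⟨ 𝕆⇒k̄ refl ⟩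
    act σ (act τ x)                       ≈⟨ f (act τ x) ⟩
    act τ x ^ᵏ (q ℕ.^ (m ℕ.+ d))          ≈⟨ ^ᵏ-+ (act τ x) m d ⟨
    (act τ x ^ᵏ (q ℕ.^ m)) ^ᵏ (q ℕ.^ d)   ≈⟨ ^ᵏ-congˡ (q ℕ.^ d) (g (act τ x)) ⟨
    act (inv τ) (act τ x) ^ᵏ (q ℕ.^ d)    ≈⟨ ^ᵏ-congˡ (q ℕ.^ d) (𝕆⇒k̄ (from∘to τ (proj₁ x))) ⟩
    x ^ᵏ (q ℕ.^ d)                        ∎

  frob-cancelˡ : ∀ m d {σ τ} → ActsAsFrobenius^ m (inv σ) → ActsAsFrobenius^ (m ℕ.+ d) τ →
                 ActsAsFrobenius^ d (σ ∙ τ)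
  frob-cancelˡ m d {σ} {τ} f g x = begin
    act (σ ∙ τ) x                         ≈⟨ 𝕆⇒k̄ refl ⟩
    act σ (act τ x)                       ≈⟨ act-cong σ (g x) ⟩
    act σ (x ^ᵏ (q ℕ.^ (m ℕ.+ d)))        ≈⟨ act-^ σ x (q ℕ.^ (m ℕ.+ d)) ⟩
    act σ x ^ᵏ (q ℕ.^ (m ℕ.+ d))          ≈⟨ ^ᵏ-+ (act σ x) m d ⟨
    (act σ x ^ᵏ (q ℕ.^ m)) ^ᵏ (q ℕ.^ d)   ≈⟨ ^ᵏ-congˡ (q ℕ.^ d) (f (act σ x)) ⟨
    act (inv σ) (act σ x) ^ᵏ (q ℕ.^ d)    ≈⟨ ^ᵏ-congˡ (q ℕ.^ d) (𝕆⇒k̄ (from∘to σ (proj₁ x))) ⟩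
    x ^ᵏ (q ℕ.^ d)                        ∎

  frob-resp : ∀ n {σ τ} → (∀ x → to σ x ≈ to τ x) → ActsAsFrobenius^ n σ → ActsAsFrobenius^ n τ
  frob-resp n e f x = k̄.trans (act-resp e x) (f x)

  split : ∀ m n → (∃[ d ] m ℕ.+ d ≡ n) ⊎ (∃[ d ] n ℕ.+ d ≡ m)
  split m n with ℕ.≤-total m n
  ... | inj₁ h = inj₁ (n ℕ.∸ m , ℕ.m+[n∸m]≡n h)
  ... | inj₂ h = inj₂ (m ℕ.∸ n , ℕ.m+[n∸m]≡n h)

  weil-∙ : ∀ {σ τ} → InWeil σ → InWeil τ → InWeil (σ ∙ τ)
  weil-∙ {σ} {τ} (m , inj₁ f) (n , inj₁ g) = m ℕ.+ n , inj₁ (frob-comp m n {σ} {τ} f g)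
  weil-∙ {σ} {τ} (m , inj₂ f) (n , inj₂ g) = n ℕ.+ m ,
    inj₂ (frob-resp (n ℕ.+ m) {inv τ ∙ inv σ} {inv (σ ∙ τ)} (λ _ → refl)
           (frob-comp n m {inv τ} {inv σ} g f))
  weil-∙ {σ} {τ} (m , inj₁ f) (n , inj₂ g) with split m n
  ... | inj₁ (d , ≡.refl) = d ,
    inj₂ (frob-resp d {inv τ ∙ inv σ} {inv (σ ∙ τ)} (λ _ → refl)
           (frob-cancelʳ m d {inv τ} {inv σ} g (frob-resp m {σ} {inv (inv σ)} (λ _ → refl) f)))
  ... | inj₂ (d , ≡.refl) = d , inj₁ (frob-cancelʳ n d {σ} {τ} f g)
  weil-∙ {σ} {τ} (m , inj₂ f) (n , inj₁ g) with split m n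
  ... | inj₁ (d , ≡.refl) = d , inj₁ (frob-cancelˡ m d {σ} {τ} f g)
  ... | inj₂ (d , ≡.refl) = d ,
    inj₂ (frob-resp d {inv τ ∙ inv σ} {inv (σ ∙ τ)} (λ _ → refl)
           (frob-cancelˡ n d {inv τ} {inv σ} (frob-resp n {τ} {inv (inv τ)} (λ _ → refl) g) f))

  weil-inv : ∀ {σ} → InWeil σ → InWeil (inv σ)
  weil-inv {σ} (n , inj₁ f) = n , inj₂ (frob-resp n {σ} {inv (inv σ)} (λ _ → refl) f)
  weil-inv     (n , inj₂ f) = n , inj₁ f

  weil-resp : ∀ {σ τ} → (∀ x → to σ x ≈ to τ x) → InWeil σ → InWeil τ
  weil-resp {σ} {τ} e (n , inj₁ f) = n , inj₁ (frob-resp n {σ} {τ} e f)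
  weil-resp {σ} {τ} e (n , inj₂ f) = n , inj₂ (frob-resp n {inv σ} {inv τ}
    (Group.⁻¹-cong galoisGroup {σ} {τ} e) f)

  weilGroup : Group 0ℓ 0ℓ
  weilGroup = subgroup galoisGroup record
    { Mem      = InWeil
    ; ε-mem    = 0 , inj₁ λ x → 𝕆⇒k̄ (sym (*-identityʳ (proj₁ x)))
    ; ∙-mem    = λ {σ} {τ} → weil-∙ {σ} {τ}
    ; ⁻¹-mem   = λ {σ} → weil-inv {σ}
    ; mem-resp = λ {σ} {τ} → weil-resp {σ} {τ}
    }

  inertiaGroup : Group 0ℓ 0ℓ
  inertiaGroup = subgroup weilGroup record
    { Mem      = λ σ → ActsTrivially (proj₁ σ)
    ; ε-mem    = λ _ → 𝕆⇒k̄ refl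
    ; ∙-mem    = λ {σ} {τ} f g x → k̄.trans (𝕆⇒k̄ refl)
                   (k̄.trans (act-cong (proj₁ σ) (g x)) (f x))
    ; ⁻¹-mem   = λ {σ} f x → k̄.trans (k̄.sym (act-cong (inv (proj₁ σ)) (f x)))
                   (𝕆⇒k̄ (from∘to (proj₁ σ) (proj₁ x)))
    ; mem-resp = λ e f x → k̄.trans (act-resp e x) (f x)
    }

  module I = Group inertiaGroup
  module W = Group weilGroup

  -- As S runs over the finite sets, the subgroups FixesAll S are a neighbourhood basis of the
  -- identity both in inertiaGroup (Krull topology) and in weilGroup, where inertia is open.
  FixesAll : List Carrier → I.Carrier → Set
  FixesAll S τ = All (λ s → to (proj₁ (proj₁ τ)) s ≈ s) S

  infixr 8 _^ᵂ_
  _^ᵂ_ : W.Carrier → ℤ → W.Carrier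
  _^ᵂ_ = zpow W.rawGroup

module Representations
  {p ℓ : ℕ} (F̄ : AlgebraicClosure p) (F : Subfield (AlgebraicClosure.underlying F̄))
  (F-finite : IsFiniteExtension F̄ F) (q : ℕ) (Q̄ : AlgebraicClosure ℓ)
  where
  open Weil F̄ F F-finite q
  open AlgebraicClosure Q̄
  open Matrices commutativeRing
  open Mat
  open PAdicInt using (approx)

  Continuous : (W.Carrier → Carrier) → Set
  Continuous f = ∀ g n → ∃[ S ] (∀ τ → FixesAll S τ → Close Q̄ n (f (g W.∙ proj₁ τ)) (f g))

  record Character : Set where
    field
      value      : W.Carrier → Carrier
      isHom      : IsMonoidHomomorphism W.rawMonoid *-rawMonoid value
      continuous : Continuous value

  -- A monoid homomorphism from a group to 2 × 2 matrices takes values in GL₂.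
  record Representation : Set where
    field
      value      : W.Carrier → Mat Carrier
      isHom      : IsMonoidHomomorphism W.rawMonoid rawMonoidᴹ value
      continuous : Continuous (e₁₁ ∘ value) × Continuous (e₁₂ ∘ value) ×
                   Continuous (e₂₁ ∘ value) × Continuous (e₂₂ ∘ value)

  IsOmega : W.Carrier → Character → Set
  IsOmega Φ ω = ∀ k (τ : I.Carrier) →
    Character.value ω (Φ ^ᵂ k W.∙ proj₁ τ) ≈ zpow *-rawGroup (q ×ₙ 1#) (ℤ.- k)

  record TameCharacter (ω : Character) : Set where
    field
      value       : I.Carrier → PAdicInt ℓ
      isHom       : IsGroupHomomorphism I.rawGroup
                      (Group.rawGroup (CommutativeRing.+-group (ℤ-adic ℓ))) value
      continuous  : ∀ σ n → ∃[ S ] (∀ τ → FixesAll S τ →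
                      approx (value (σ I.∙ τ)) n ≡ approx (value σ) n [mod + (ℓ ℕ.^ n) ])
      surjective  : Surjective I._≈_ (CommutativeRing._≈_ (ℤ-adic ℓ)) value
      equivariant : ∀ g τ σ → proj₁ σ W.≈ g W.∙ proj₁ τ W.∙ g W.⁻¹ →
                      ι (value σ) ≈ Character.value ω g * ι (value τ)

  module _ (Φ : W.Carrier) (ω : Character) (t : TameCharacter ω) where

    T : I.Carrier → Carrier
    T τ = ι (TameCharacter.value t τ)

    ω· : W.Carrier → Carrier
    ω· = Character.value ω

    -- (r , N) is the Weil–Deligne representation (ρ_Φ , N_ρ) associated with ρ.
    record IsWeilDeligne (ρ : Representation) (r : W.Carrier → Mat Carrier) (N : Mat Carrier)
           : Set where
      field
        nilpotent : IsNilpotent N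
        inertial  : ∃[ S ] (∀ τ → FixesAll S τ →
                      Representation.value ρ (proj₁ τ) ≈ᴹ expᴹ (T τ ·ᴹ N))
        formula   : ∀ k (τ : I.Carrier) → r (Φ ^ᵂ k W.∙ proj₁ τ) ≈ᴹ
                      Representation.value ρ (Φ ^ᵂ k W.∙ proj₁ τ) *ᴹ expᴹ ((- T τ) ·ᴹ N)

    -- The Weil–Deligne representation of ρ is isomorphic to χω ⊕ χ with monodromy (0 1 ; 0 0).
    -- In particular ρ is special.
    IsSpecialFor : Representation → Character → Set
    IsSpecialFor ρ χ =
      ∃[ r ] ∃[ N ] IsWeilDeligne ρ r N ×
      (Σ[ C ∈ Conjugator ]
        (∀ g → Conjugator.P C *ᴹ r g ≈ᴹ
               mat (Character.value χ g * ω· g) 0# 0# (Character.value χ g) *ᴹ Conjugator.P C) ×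
        (Conjugator.P C *ᴹ N ≈ᴹ mat 0# 1# 0# 0# *ᴹ Conjugator.P C))

    -- u and b′ stand for the quotients a/d and b/d of the entries of (a b ; 0 d).
    HasTriangularForm : Representation → Character → Carrier → Carrier → Set
    HasTriangularForm ρ χ u b′ = ∀ k (τ : I.Carrier) →
      let g  = Φ ^ᵂ k W.∙ proj₁ τ
          χg = Character.value χ g
          χω = Character.value χ g * ω· g
      in Representation.value ρ g ≈ᴹ mat χω (u * T τ * χω + b′ * (χg - χω)) 0# χg

  module Reduction (K : Subfield underlying) where
    O k : CommutativeRing 0ℓ 0ℓ
    O = 𝓞 Q̄ K
    k = residueField Q̄ K

    module O = CommutativeRing O
    module k = CommutativeRing k

    InO : Carrier → Set
    InO = Subring.Mem (integers Q̄ K)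

    IsUnitOfO : Carrier → Set
    IsUnitOfO x = Σ[ m ∈ InO x ] IsUnit O (x , m)

    record InGL₂O (M : Mat Carrier) : Set where
      field
        m₁₁ : InO (e₁₁ M)
        m₁₂ : InO (e₁₂ M)
        m₂₁ : InO (e₂₁ M)
        m₂₂ : InO (e₂₂ M)

      overO : Mat O.Carrier
      overO = mat (e₁₁ M , m₁₁) (e₁₂ M , m₁₂) (e₂₁ M , m₂₁) (e₂₂ M , m₂₂)

      field
        det-unit : IsUnit O (Matrices.det O overO)

    IsIntegralRep : Representation → Set
    IsIntegralRep ρ = ∀ g → InGL₂O (Representation.value ρ g)

    reduction : (ρ : Representation) → IsIntegralRep ρ → W.Carrier → Mat k.Carrier
    reduction ρ int g = InGL₂O.overO (int g)

    -- χ and θ are integral with the same reduction.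
    SameReduction : Character → Character → Set
    SameReduction χ θ = ∀ g →
      Σ[ m ∈ InO (Character.value χ g) ] Σ[ n ∈ InO (Character.value θ g) ]
        (Character.value χ g , m) k.≈ (Character.value θ g , n)

    IsMaximalCongruence : ℕ → Set
    IsMaximalCongruence i = Congruent^ i × (∀ j → Congruent^ j → j ℕ.≤ i)
      where
      Congruent^ : ℕ → Set
      Congruent^ j = PowerMem O (maximalIdeal Q̄ K) j ((q ×ₒ O.1#) O.- O.1#)
        where open RawSemiringDefs (Semiring.rawSemiring O.semiring) using () renaming (_×_ to _×ₒ_)

{-# OPTIONS --safe #-}
-- Put u = a/d and β = b/d, so that v(u₂β₁ − u₁β₂) is the valuation in the statement.  At an element
-- of inertia with t = 1 both reductions are a scalar times a non-trivial unipotent matrix (1 u; 0 1),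
-- so an intertwining matrix (x y; z w) is upper triangular modulo λ and has x u₁ ≡ w u₂; comparing
-- lower right entries gives χ ≡ θ.  Its upper right entry at Φ then says that
-- (1 − ω(Φ)) (u₂β₁ − u₁β₂) lies in λ if q ≡ 1, while integrality of ρ₁(Φ) and ρ₂(Φ) always puts it
-- in 𝓞; since v(1 − ω(Φ)) = v(q − 1) = i, this is the bound.  Conversely (u₂ y; 0 u₁) intertwines
-- the reductions, with y = 0 if i ≥ 1 and y = −(u₂β₁ − u₁β₂) if i = 0.
module Submission where

open import Defs
open import Algebra.Bundles using (CommutativeRing; RawRing)
import Algebra.Definitions.RawMonoid as RawMonoidDefs
open import Algebra.Morphism.Structures
  using (IsGroupHomomorphism; IsMonoidHomomorphism; IsRingMonomorphism)
import Algebra.Properties.AbelianGroup as AbelianGroupProperties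
import Algebra.Properties.CommutativeSemigroup as CommutativeSemigroupProperties
import Algebra.Properties.Ring as RingProperties
import Algebra.Properties.Semiring.Mult.TCOptimised as Mult
import Algebra.Solver.Ring as RingSolver
open import Algebra.Solver.Ring.AlmostCommutativeRing
  using (_-Raw-AlmostCommutative⟶_; fromCommutativeRing)
open import Data.Integer.Base as ℤ using (ℤ; +_; -[1+_]; 0ℤ; 1ℤ)
import Data.Integer.Properties as ℤ
open import Data.Integer.Tactic.RingSolver using (solve-∀)
open import Data.List.Base using ([]; _∷_)
open import Data.Maybe.Base using (Maybe; just; nothing)
open import Data.Nat.Base as ℕ using (ℕ; zero; suc)
open import Data.Nat.Primality using (Prime)
import Data.Nat.Properties as ℕ
open import Data.Product.Base using (Σ-syntax; ∃-syntax; _×_; _,_; proj₁; proj₂)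
open import Data.Sum.Base using (inj₁; inj₂)
open import Data.Unit.Base using (tt)
open import Function.Bundles using (_⇔_; mk⇔; module Equivalence)
open import Level using (0ℓ)
open import Relation.Binary.Construct.Add.Supremum.NonStrict ℤ._≤_
  using (_≤⁺_; [_]; _≤⊤⁺; [≤]-injective; ≤⁺-trans)
open import Relation.Binary.PropositionalEquality as ≡ using (_≡_; _≢_)
open import Relation.Nullary.Construct.Add.Supremum using (_⁺; ⊤⁺; [_]; []-injective)
open import Relation.Nullary.Decidable.Core using (yes; no)
open import Relation.Nullary.Negation.Core using (¬_; contradiction)

-- A ring solver with integer coefficients.

module IntegerCoefficients (R : CommutativeRing 0ℓ 0ℓ) where
  open CommutativeRing R
  open Mult semiring using (×-homo-+; ×1-homo-*) renaming (_×_ to _×′_)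
  open RingProperties ring using (-‿+-comm; -0#≈0#; -‿distribˡ-*; -‿distribʳ-*)
  open AbelianGroupProperties +-abelianGroup using () renaming (⁻¹-involutive to neg-involutive)
  open CommutativeSemigroupProperties +-commutativeSemigroup using (interchange)
  open import Relation.Binary.Reasoning.Setoid setoid

  -- ⟦ a , b ⟧ is the integer a − b, split so that ⟦ 1 , 0 ⟧ reduces to 1#.
  ⟦_⟧ : ℕ × ℕ → Carrier
  ⟦ a , zero  ⟧ = a ×′ 1#
  ⟦ a , suc b ⟧ = a ×′ 1# - suc b ×′ 1#

  ⟦⟧≈ : ∀ a b → ⟦ a , b ⟧ ≈ a ×′ 1# - b ×′ 1#
  ⟦⟧≈ a zero    = sym (trans (+-congˡ -0#≈0#) (+-identityʳ (a ×′ 1#)))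
  ⟦⟧≈ a (suc b) = refl

  -- A pair represents an integer only up to the usual equivalence of formal differences; this is
  -- what makes `equal?` sound.
  ⟦⟧-cong : ∀ a b c d → a ℕ.+ d ≡ c ℕ.+ b → ⟦ a , b ⟧ ≈ ⟦ c , d ⟧
  ⟦⟧-cong a b c d e = begin
    ⟦ a , b ⟧                              ≈⟨ ⟦⟧≈ a b ⟩
    A - B                                  ≈⟨ +-identityʳ _ ⟨
    (A - B) + 0#                           ≈⟨ +-congˡ (-‿inverseʳ D) ⟨
    (A - B) + (D - D)                      ≈⟨ interchange _ _ _ _ ⟩
    (A + D) + (- B - D)                    ≈⟨ +-cong A+D≈C+B (+-comm _ _) ⟩
    (C + B) + (- D - B)                    ≈⟨ interchange _ _ _ _ ⟩
    (C - D) + (B - B)                      ≈⟨ +-congˡ (-‿inverseʳ B) ⟩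
    (C - D) + 0#                           ≈⟨ +-identityʳ _ ⟩
    C - D                                  ≈⟨ ⟦⟧≈ c d ⟨
    ⟦ c , d ⟧                              ∎
    where
    A B C D : Carrier
    A = a ×′ 1#
    B = b ×′ 1#
    C = c ×′ 1#
    D = d ×′ 1#

    A+D≈C+B : A + D ≈ C + B
    A+D≈C+B = trans (sym (×-homo-+ 1# a d))
      (trans (reflexive (≡.cong (_×′ 1#) e)) (×-homo-+ 1# c b))

  -- Without this the solver would compare coefficients such as (1 , 1) and (0 , 0) syntactically.
  reduce : ℕ × ℕ → ℕ × ℕ
  reduce (a , b) = a ℕ.∸ b , b ℕ.∸ a

  ⟦reduce⟧ : ∀ a b → ⟦ reduce (a , b) ⟧ ≈ ⟦ a , b ⟧
  ⟦reduce⟧ a b = ⟦⟧-cong (a ℕ.∸ b) (b ℕ.∸ a) a b (balanced a b)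
    where
    balanced : ∀ a b → (a ℕ.∸ b) ℕ.+ b ≡ a ℕ.+ (b ℕ.∸ a)
    balanced zero    zero    = ≡.refl
    balanced zero    (suc b) = ≡.refl
    balanced (suc a) zero    = ≡.refl
    balanced (suc a) (suc b) = ≡.trans (ℕ.+-suc (a ℕ.∸ b) b) (≡.cong suc (balanced a b))

  -- Sums and products are reduced after the fact, while negation merely swaps the components and so
  -- keeps a reduced pair reduced.
  differences : RawRing 0ℓ 0ℓ
  differences = record
    { Carrier = ℕ × ℕ
    ; _≈_     = _≡_
    ; _+_     = λ (a , b) (c , d) → reduce (a ℕ.+ c , b ℕ.+ d)
    ; _*_     = λ (a , b) (c , d) → reduce (a ℕ.* c ℕ.+ b ℕ.* d , a ℕ.* d ℕ.+ b ℕ.* c)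
    ; -_      = λ (a , b) → b , a
    ; 0#      = 0 , 0
    ; 1#      = 1 , 0
    }

  +-homo : ∀ x y → ⟦ RawRing._+_ differences x y ⟧ ≈ ⟦ x ⟧ + ⟦ y ⟧
  +-homo (a , b) (c , d) = begin
    ⟦ reduce (a ℕ.+ c , b ℕ.+ d) ⟧                    ≈⟨ ⟦reduce⟧ (a ℕ.+ c) (b ℕ.+ d) ⟩
    ⟦ a ℕ.+ c , b ℕ.+ d ⟧                             ≈⟨ ⟦⟧≈ (a ℕ.+ c) (b ℕ.+ d) ⟩
    (a ℕ.+ c) ×′ 1# - (b ℕ.+ d) ×′ 1#                 ≈⟨ +-cong (×-homo-+ 1# a c)
                                                                 (-‿cong (×-homo-+ 1# b d)) ⟩
    (a ×′ 1# + c ×′ 1#) - (b ×′ 1# + d ×′ 1#)         ≈⟨ +-congˡ (-‿+-comm _ _) ⟨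
    (a ×′ 1# + c ×′ 1#) + (- (b ×′ 1#) - d ×′ 1#)     ≈⟨ interchange _ _ _ _ ⟩
    (a ×′ 1# - b ×′ 1#) + (c ×′ 1# - d ×′ 1#)         ≈⟨ +-cong (⟦⟧≈ a b) (⟦⟧≈ c d) ⟨
    ⟦ a , b ⟧ + ⟦ c , d ⟧                             ∎

  -‿homo : ∀ x → ⟦ RawRing.-_ differences x ⟧ ≈ - ⟦ x ⟧
  -‿homo (a , b) = begin
    ⟦ b , a ⟧                     ≈⟨ ⟦⟧≈ b a ⟩
    b ×′ 1# - a ×′ 1#             ≈⟨ +-comm _ _ ⟩
    - (a ×′ 1#) + b ×′ 1#         ≈⟨ +-congˡ (neg-involutive _) ⟨
    - (a ×′ 1#) - - (b ×′ 1#)     ≈⟨ -‿+-comm _ _ ⟩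
    - (a ×′ 1# - b ×′ 1#)         ≈⟨ -‿cong (⟦⟧≈ a b) ⟨
    - ⟦ a , b ⟧                   ∎

  *-homo : ∀ x y → ⟦ RawRing._*_ differences x y ⟧ ≈ ⟦ x ⟧ * ⟦ y ⟧
  *-homo (a , b) (c , d) = begin
    ⟦ reduce (a ℕ.* c ℕ.+ b ℕ.* d , a ℕ.* d ℕ.+ b ℕ.* c) ⟧
      ≈⟨ ⟦reduce⟧ (a ℕ.* c ℕ.+ b ℕ.* d) (a ℕ.* d ℕ.+ b ℕ.* c) ⟩
    ⟦ a ℕ.* c ℕ.+ b ℕ.* d , a ℕ.* d ℕ.+ b ℕ.* c ⟧
      ≈⟨ ⟦⟧≈ (a ℕ.* c ℕ.+ b ℕ.* d) (a ℕ.* d ℕ.+ b ℕ.* c) ⟩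
    (a ℕ.* c ℕ.+ b ℕ.* d) ×′ 1# - (a ℕ.* d ℕ.+ b ℕ.* c) ×′ 1#
      ≈⟨ +-cong (expand a c b d) (-‿cong (expand a d b c)) ⟩
    (A * C + B * D) - (A * D + B * C)
      ≈⟨ +-congˡ (-‿+-comm _ _) ⟨
    (A * C + B * D) + (- (A * D) - B * C)
      ≈⟨ +-congˡ (+-comm _ _) ⟩
    (A * C + B * D) + (- (B * C) - A * D)
      ≈⟨ interchange _ _ _ _ ⟩
    (A * C - B * C) + (B * D - A * D)
      ≈⟨ +-cong (+-congˡ (-‿distribˡ-* B C))
                (trans (+-comm _ _) (+-cong (-‿distribʳ-* A D)
                  (trans (sym (neg-involutive _))
                    (trans (-‿cong (-‿distribˡ-* B D)) (-‿distribʳ-* (- B) D))))) ⟩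
    (A * C + - B * C) + (A * - D + - B * - D)
      ≈⟨ +-cong (distribʳ C A (- B)) (distribʳ (- D) A (- B)) ⟨
    (A - B) * C + (A - B) * - D
      ≈⟨ distribˡ (A - B) C (- D) ⟨
    (A - B) * (C - D)
      ≈⟨ *-cong (⟦⟧≈ a b) (⟦⟧≈ c d) ⟨
    ⟦ a , b ⟧ * ⟦ c , d ⟧ ∎
    where
    A B C D : Carrier
    A = a ×′ 1#
    B = b ×′ 1#
    C = c ×′ 1#
    D = d ×′ 1#

    expand : ∀ k l m n → (k ℕ.* l ℕ.+ m ℕ.* n) ×′ 1# ≈ (k ×′ 1#) * (l ×′ 1#) + (m ×′ 1#) * (n ×′ 1#)
    expand k l m n = trans (×-homo-+ 1# (k ℕ.* l) (m ℕ.* n)) (+-cong (×1-homo-* k l) (×1-homo-* m n))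

  morphism : differences -Raw-AlmostCommutative⟶ fromCommutativeRing R
  morphism = record
    { ⟦_⟧    = ⟦_⟧
    ; +-homo = +-homo
    ; *-homo = *-homo
    ; -‿homo = -‿homo
    ; 0-homo = refl
    ; 1-homo = refl
    }

  equal? : ∀ x y → Maybe (⟦ x ⟧ ≈ ⟦ y ⟧)
  equal? (a , b) (c , d) with a ℕ.+ d ℕ.≟ c ℕ.+ b
  ... | no  _ = nothing
  ... | yes e = just (⟦⟧-cong a b c d e)

  open RingSolver differences (fromCommutativeRing R) morphism equal? public
    using (solve; con; _:=_; _:+_; _:*_; _:-_; :-_)

-- Quotients in a field.

module _ (E : Field) where
  open Field E
  open IntegerCoefficients commutativeRing
  open import Relation.Binary.Reasoning.Setoid setoid

  *-nonzero : ∀ {x y} → x ≉ 0# → y ≉ 0# → x * y ≉ 0#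
  *-nonzero {x} {y} x≉0 y≉0 xy≈0 = y≉0 (begin
    y                 ≈⟨ *-identityˡ y ⟨
    1# * y            ≈⟨ *-congʳ (*-⁻¹ x x≉0) ⟨
    x * x ⁻¹ * y      ≈⟨ solve 3 (λ x x′ y → x :* x′ :* y := x′ :* (x :* y)) refl x (x ⁻¹) y ⟩
    x ⁻¹ * (x * y)    ≈⟨ *-congˡ xy≈0 ⟩
    x ⁻¹ * 0#         ≈⟨ zeroʳ (x ⁻¹) ⟩
    0#                ∎)

  -- The matrix computations produce the left side; the right side exhibits the quotient of the
  -- statement, up to the factor `a₁ / d₁`, which is a unit of 𝓞 in the application.
  cross-difference : ∀ {a₁ d₁ a₂ d₂} b₁ b₂ → a₁ * d₁ ≉ 0# → a₂ * d₂ ≉ 0# →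
    a₂ / d₂ * (b₁ / d₁) - a₁ / d₁ * (b₂ / d₂) ≈ a₁ / d₁ * ((a₂ * b₁ - a₁ * b₂) / (a₁ * d₂))
  cross-difference {a₁} {d₁} {a₂} {d₂} b₁ b₂ a₁d₁≉0 a₂d₂≉0 = begin
    a₂ / d₂ * (b₁ / d₁) - a₁ / d₁ * (b₂ / d₂)
      -- The trailing factor 1 is a placeholder, expanded next into a₁d₂ times its inverse.
      ≈⟨ solve 6 (λ a₁ d₁′ a₂ d₂′ b₁ b₂ → a₂ :* d₂′ :* (b₁ :* d₁′) :- a₁ :* d₁′ :* (b₂ :* d₂′)
                    := (a₂ :* b₁ :- a₁ :* b₂) :* d₁′ :* d₂′ :* con (1 , 0))
           refl a₁ (d₁ ⁻¹) a₂ (d₂ ⁻¹) b₁ b₂ ⟩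
    N * d₁ ⁻¹ * d₂ ⁻¹ * 1#
      ≈⟨ *-congˡ (*-⁻¹ (a₁ * d₂) (*-nonzero a₁≉0 d₂≉0)) ⟨
    N * d₁ ⁻¹ * d₂ ⁻¹ * (a₁ * d₂ * (a₁ * d₂) ⁻¹)
      ≈⟨ solve 6 (λ N a₁ d₁′ d₂ d₂′ f → N :* d₁′ :* d₂′ :* (a₁ :* d₂ :* f)
                    := a₁ :* d₁′ :* (N :* f) :* (d₂ :* d₂′))
           refl N a₁ (d₁ ⁻¹) d₂ (d₂ ⁻¹) ((a₁ * d₂) ⁻¹) ⟩
    a₁ / d₁ * (N / (a₁ * d₂)) * (d₂ * d₂ ⁻¹)
      ≈⟨ *-congˡ (*-⁻¹ d₂ d₂≉0) ⟩
    a₁ / d₁ * (N / (a₁ * d₂)) * 1#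
      ≈⟨ *-identityʳ _ ⟩
    a₁ / d₁ * (N / (a₁ * d₂)) ∎
    where
    N : Carrier
    N = a₂ * b₁ - a₁ * b₂

    a₁≉0 : a₁ ≉ 0#
    a₁≉0 e = a₁d₁≉0 (trans (*-congʳ e) (zeroˡ d₁))

    d₂≉0 : d₂ ≉ 0#
    d₂≉0 e = a₂d₂≉0 (trans (*-congˡ e) (zeroʳ a₂))

-- The filtration of K by powers of λ.

module Filtration
  {ℓ : ℕ} (Q̄ : AlgebraicClosure ℓ) (K : Subfield (AlgebraicClosure.underlying Q̄))
  (v : Field.Carrier (subfield (AlgebraicClosure.underlying Q̄) K) → ℤ ⁺)
  (normalized : IsNormalizedValuation Q̄ K v)
  where
  open AlgebraicClosure Q̄
  open IsNormalizedValuation normalized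
  open IsValuation isValuation
  open IntegerCoefficients commutativeRing
  private
    module K = Subfield K
    module O = CommutativeRing (𝓞 Q̄ K)
    module 𝔬 = Subring (integers Q̄ K)

  -- The fractional ideal λⁿ of K, as a predicate on the ambient field.
  𝔭^ : ℤ → Carrier → Set
  𝔭^ n x = Σ[ m ∈ K.Mem x ] [ n ] ≤⁺ v (x , m)

  -- Equality in K compares only underlying elements, so the valuation does not depend on which
  -- proof of membership in K is supplied.
  𝔭^⇒v : ∀ {n x} → 𝔭^ n x → (m : K.Mem x) → [ n ] ≤⁺ v (x , m)
  𝔭^⇒v {n} (_ , h) m = ≡.subst ([ n ] ≤⁺_) (v-cong refl) h

  𝔭^-resp : ∀ {n x y} → x ≈ y → 𝔭^ n x → 𝔭^ n y
  𝔭^-resp {n} e (m , h) = K.mem-resp e m , ≡.subst ([ n ] ≤⁺_) (v-cong e) h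

  𝔭^-mono : ∀ {m n x} → m ℤ.≤ n → 𝔭^ n x → 𝔭^ m x
  𝔭^-mono m≤n (k , h) = k , ≤⁺-trans ℤ.≤-trans [ m≤n ] h

  𝔭^-+ : ∀ {n x y} → 𝔭^ n x → 𝔭^ n y → 𝔭^ n (x + y)
  𝔭^-+ {n} {x} {y} (k , h) (l , h′) = K.+-mem k l , v-+ [ n ] (x , k) (y , l) h h′

  𝔭^-* : ∀ {m n x y} → 𝔭^ m x → 𝔭^ n y → 𝔭^ (m ℤ.+ n) (x * y)
  𝔭^-* {m} {n} {x} {y} (k , h) (l , h′) =
    K.*-mem k l , ≡.subst ([ m ℤ.+ n ] ≤⁺_) (≡.sym (v-* (x , k) (y , l))) (add h h′)
    where
    add : ∀ {s t} → [ m ] ≤⁺ s → [ n ] ≤⁺ t → [ m ℤ.+ n ] ≤⁺ lift⁺ ℤ._+_ s t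
    add {[ _ ]} {[ _ ]} [ a ]      [ b ]      = [ ℤ.+-mono-≤ a b ]
    add {[ _ ]} {⊤⁺}    _          _          = _ ≤⊤⁺
    add {⊤⁺}            _          _          = _ ≤⊤⁺

  𝔭^-0 : ∀ {n x} → x ≈ 0# → 𝔭^ n x
  𝔭^-0 {n} {x} e = k , ≡.subst ([ n ] ≤⁺_) (≡.sym (Equivalence.from (v-∞ (x , k)) e)) (_ ≤⊤⁺)
    where
    k : K.Mem x
    k = K.mem-resp (sym e) K.0-mem

  integral⇒𝔭⁰ : ∀ {x} → 𝔬.Mem x → 𝔭^ 0ℤ x
  integral⇒𝔭⁰ {x} (k , j) = k , Equivalence.from (integers⇔ (x , k)) j

  𝔭⁰⇒integral : ∀ {x} → 𝔭^ 0ℤ x → 𝔬.Mem x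
  𝔭⁰⇒integral {x} (k , h) = k , Equivalence.to (integers⇔ (x , k)) h

  𝔭^-*ˡ : ∀ {n x y} → 𝔭^ 0ℤ x → 𝔭^ n y → 𝔭^ n (x * y)
  𝔭^-*ˡ {n} h h′ = ≡.subst (λ j → 𝔭^ j _) (ℤ.+-identityˡ n) (𝔭^-* h h′)

  𝔭^-*ʳ : ∀ {n x y} → 𝔭^ n x → 𝔭^ 0ℤ y → 𝔭^ n (x * y)
  𝔭^-*ʳ {x = x} {y} h h′ = 𝔭^-resp (*-comm y x) (𝔭^-*ˡ h′ h)

  𝔭⁰-1 : 𝔭^ 0ℤ 1#
  𝔭⁰-1 = integral⇒𝔭⁰ 𝔬.1-mem

  𝔭^-neg : ∀ {n x} → 𝔭^ n x → 𝔭^ n (- x)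
  𝔭^-neg {x = x} h = 𝔭^-resp (solve 1 (λ x → (:- con (1 , 0)) :* x := :- x) refl x)
    (𝔭^-*ˡ (integral⇒𝔭⁰ (𝔬.neg-mem 𝔬.1-mem)) h)

  𝔭^-- : ∀ {n x y} → 𝔭^ n x → 𝔭^ n y → 𝔭^ n (x - y)
  𝔭^-- h h′ = 𝔭^-+ h (𝔭^-neg h′)

  𝔭¹⊆𝔭⁰ : ∀ {x} → 𝔭^ 1ℤ x → 𝔭^ 0ℤ x
  𝔭¹⊆𝔭⁰ = 𝔭^-mono (ℤ.+≤+ ℕ.z≤n)

  -- From 1 · 1 = 1 the value is idempotent under addition, and it is finite because 1 is not 0.
  v-1 : v (1# , K.1-mem) ≡ [ 0ℤ ]
  v-1 = idempotent (v (1# , K.1-mem)) (λ e → 1≉0 (Equivalence.to (v-∞ (1# , K.1-mem)) e))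
    (≡.trans (v-cong (sym (*-identityˡ 1#))) (v-* (1# , K.1-mem) (1# , K.1-mem)))
    where
    open AbelianGroupProperties ℤ.+-0-abelianGroup using (identityˡ-unique)

    idempotent : ∀ s → s ≢ ⊤⁺ → s ≡ lift⁺ ℤ._+_ s s → s ≡ [ 0ℤ ]
    idempotent ⊤⁺    s≢∞ _ = contradiction ≡.refl s≢∞
    idempotent [ a ] _   e = ≡.cong [_] (identityˡ-unique a a (≡.sym ([]-injective e)))

  1∉𝔭 : ¬ 𝔭^ 1ℤ 1#
  1∉𝔭 (k , h) with [≤]-injective (≡.subst ([ 1ℤ ] ≤⁺_) (≡.trans (v-cong refl) v-1) h)
  ... | ℤ.+≤+ ()

  -- The exact valuation of `x` is required: a lower bound for it would not bound the valuation of
  -- `y` from below.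
  𝔭^-cancel : ∀ {m n x y} (k : K.Mem x) → v (x , k) ≡ [ n ] → K.Mem y →
              𝔭^ m (x * y) → 𝔭^ (m ℤ.- n) y
  𝔭^-cancel {m} {n} {x} {y} k e l (k′ , h) = l ,
    shift (v (y , l)) (≡.subst ([ m ] ≤⁺_)
      (≡.trans (v-cong refl) (≡.trans (v-* (x , k) (y , l)) (≡.cong (λ s → lift⁺ ℤ._+_ s (v (y , l))) e))) h)
    where
    shift : ∀ s → [ m ] ≤⁺ lift⁺ ℤ._+_ [ n ] s → [ m ℤ.- n ] ≤⁺ s
    shift ⊤⁺    _     = _ ≤⊤⁺
    shift [ a ] [ b ] = [ ≡.subst (m ℤ.- n ℤ.≤_) (n+a-n n a) (ℤ.+-monoˡ-≤ (ℤ.- n) b) ]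
      where
      n+a-n : ∀ n a → n ℤ.+ a ℤ.- n ≡ a
      n+a-n = solve-∀

  -- Units of 𝓞 as elements of the ambient field, so that identities can be solved there without
  -- transporting membership proofs.
  record Unit (x : Carrier) : Set where
    field
      integral   : 𝔭^ 0ℤ x
      inverse    : Carrier
      integral⁻¹ : 𝔭^ 0ℤ inverse
      isInverse  : x * inverse ≈ 1#

  unit : ∀ {x} (m : 𝔬.Mem x) → IsUnit (𝓞 Q̄ K) (x , m) → Unit x
  unit m ((y , m′) , e) = record
    { integral = integral⇒𝔭⁰ m ; inverse = y ; integral⁻¹ = integral⇒𝔭⁰ m′ ; isInverse = e }

  unit-cancel : ∀ {n x y} → Unit x → 𝔭^ n (x * y) → 𝔭^ n y
  unit-cancel {x = x} {y} u h = 𝔭^-resp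
    (trans (solve 3 (λ x y z → z :* (x :* y) := (x :* z) :* y) refl x y inverse)
      (trans (*-congʳ isInverse) (*-identityˡ y)))
    (𝔭^-*ˡ integral⁻¹ h)
    where open Unit u

  unit∉𝔭 : ∀ {x} → Unit x → ¬ 𝔭^ 1ℤ x
  unit∉𝔭 {x} u h = 1∉𝔭 (𝔭^-resp (Unit.isInverse u) (𝔭^-*ʳ h (Unit.integral⁻¹ u)))

  𝔭¹⇒nonunit : ∀ {x} (m : 𝔬.Mem x) → 𝔭^ 1ℤ x → ¬ IsUnit (𝓞 Q̄ K) (x , m)
  𝔭¹⇒nonunit m h u = unit∉𝔭 (unit m u) h

  -- Cancelling `x`, of valuation 0, from x x⁻¹ = 1 shows that the inverse taken in the field is
  -- integral.
  v≡0⇒unit : ∀ {x} (m : 𝔬.Mem x) → v (x , proj₁ m) ≡ [ 0ℤ ] → IsUnit (𝓞 Q̄ K) (x , m)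
  v≡0⇒unit {x} (k , _) e = (x ⁻¹ , 𝔭⁰⇒integral (𝔭^-cancel k e (K.⁻¹-mem k)
      (𝔭^-resp (sym inv) 𝔭⁰-1))) , inv
    where
    x≉0 : x ≉ 0#
    x≉0 x≈0 with ≡.trans (≡.sym e) (Equivalence.from (v-∞ (x , k)) x≈0)
    ... | ()

    inv : x * x ⁻¹ ≈ 1#
    inv = *-⁻¹ x x≉0

  -- Values are integers and 0 is excluded by `v≡0⇒unit`, so a non-negative value is at least 1.
  -- With `𝔭¹⇒nonunit` this identifies `maximalIdeal` with `𝔭^ 1ℤ`.
  nonunit⇒𝔭¹ : ∀ {x} (m : 𝔬.Mem x) → ¬ IsUnit (𝓞 Q̄ K) (x , m) → 𝔭^ 1ℤ x
  nonunit⇒𝔭¹ {x} m ¬u = proj₁ m , positive (v (x , proj₁ m)) ≡.refl (proj₂ (integral⇒𝔭⁰ m))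
    where
    positive : ∀ s → v (x , proj₁ m) ≡ s → [ 0ℤ ] ≤⁺ s → [ 1ℤ ] ≤⁺ s
    positive ⊤⁺            _ _ = _ ≤⊤⁺
    positive [ + zero ]    e _ = contradiction (v≡0⇒unit m e) ¬u
    positive [ + suc n ]   _ _ = [ ℤ.+≤+ (ℕ.s≤s ℕ.z≤n) ]
    positive [ -[1+ n ] ]  _ [ () ]

  -- If `x` were a unit it could be cancelled from its square, which would put `x` itself in λ.
  𝔭-radical : ∀ {x} → 𝔭^ 0ℤ x → 𝔭^ 1ℤ (x * x) → 𝔭^ 1ℤ x
  𝔭-radical {x} h h² = nonunit⇒𝔭¹ m λ u →
    unit∉𝔭 (unit m u) (unit-cancel (unit m u) h²)
    where
    m : 𝔬.Mem x
    m = 𝔭⁰⇒integral h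

  PowerMem⇒𝔭^ : ∀ n {x} → PowerMem (𝓞 Q̄ K) (maximalIdeal Q̄ K) n x → 𝔭^ (+ n) (proj₁ x)
  PowerMem⇒𝔭^ zero    {x} _ = integral⇒𝔭⁰ (proj₂ x)
  PowerMem⇒𝔭^ (suc n) h     = sums h
    where
    sums : ∀ {z} → ProductMem (𝓞 Q̄ K) (Ideal.Mem (maximalIdeal Q̄ K))
                     (PowerMem (𝓞 Q̄ K) (maximalIdeal Q̄ K) n) z → 𝔭^ (+ suc n) (proj₁ z)
    sums (nil e)                = 𝔭^-0 e
    sums (cons {x} i j s e) = 𝔭^-resp (sym e)
      (𝔭^-+ (𝔭^-* (nonunit⇒𝔭¹ (proj₂ x) i) (PowerMem⇒𝔭^ n j)) (sums s))

  -- A single product suffices: x = π (π⁻¹ x), where dividing by a uniformizer lowers the exponent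
  -- by one.
  𝔭^⇒PowerMem : ∀ n {x} → 𝔭^ (+ n) (proj₁ x) → PowerMem (𝓞 Q̄ K) (maximalIdeal Q̄ K) n x
  𝔭^⇒PowerMem zero    _     = tt
  𝔭^⇒PowerMem (suc n) {x} h = cons
    {x = π , 𝔭⁰⇒integral (𝔭¹⊆𝔭⁰ π∈𝔭)} {y = y , 𝔭⁰⇒integral (𝔭^-mono (ℤ.+≤+ ℕ.z≤n) y∈𝔭ⁿ)} {s = O.0#}
    (𝔭¹⇒nonunit (𝔭⁰⇒integral (𝔭¹⊆𝔭⁰ π∈𝔭)) π∈𝔭) (𝔭^⇒PowerMem n y∈𝔭ⁿ) (nil refl)
    (sym (trans (+-identityʳ (π * y)) πy≈x))
    where
    π : Carrier
    π = proj₁ (proj₁ uniformizer)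

    k : K.Mem π
    k = proj₂ (proj₁ uniformizer)

    v-π : v (π , k) ≡ [ 1ℤ ]
    v-π = proj₂ uniformizer

    π∈𝔭 : 𝔭^ 1ℤ π
    π∈𝔭 = k , ≡.subst ([ 1ℤ ] ≤⁺_) (≡.sym v-π) [ ℤ.≤-refl ]

    π≉0 : π ≉ 0#
    π≉0 e with ≡.trans (≡.sym v-π) (Equivalence.from (v-∞ (π , k)) e)
    ... | ()

    y : Carrier
    y = π ⁻¹ * proj₁ x

    πy≈x : π * y ≈ proj₁ x
    πy≈x = trans (sym (*-assoc π (π ⁻¹) (proj₁ x))) (trans (*-congʳ (*-⁻¹ π π≉0)) (*-identityˡ (proj₁ x)))

    y∈𝔭ⁿ : 𝔭^ (+ n) y
    -- The exponent `+ suc n ℤ.- 1ℤ` given by the cancellation computes to `+ n`.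
    y∈𝔭ⁿ = 𝔭^-cancel k v-π (K.*-mem (K.⁻¹-mem k) (proj₁ h)) (𝔭^-resp (sym πy≈x) h)

  -- Maximality rules out every value above `i`, including ∞. The separate `z` allows for an element
  -- of K that equals the given element of 𝓞 but is built differently, as happens for q - 1.
  maximal-power⇒v : ∀ {i x} → PowerMem (𝓞 Q̄ K) (maximalIdeal Q̄ K) i x →
    (∀ j → PowerMem (𝓞 Q̄ K) (maximalIdeal Q̄ K) j x → j ℕ.≤ i) →
    ∀ {z} (m : K.Mem z) → z ≈ proj₁ x → v (z , m) ≡ [ + i ]
  maximal-power⇒v {i} {x} h max m z≈x = ≡.trans (v-cong z≈x) (exact (v (proj₁ x , k)) ≡.refl
    (𝔭^⇒v (PowerMem⇒𝔭^ i h) k))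
    where
    k : K.Mem (proj₁ x)
    k = proj₁ (proj₂ x)

    absurd : ¬ ([ + suc i ] ≤⁺ v (proj₁ x , k))
    absurd h′ = ℕ.1+n≰n (max (suc i) (𝔭^⇒PowerMem (suc i) (k , h′)))

    exact : ∀ s → v (proj₁ x , k) ≡ s → [ + i ] ≤⁺ s → s ≡ [ + i ]
    exact ⊤⁺    e _ = contradiction (≡.subst ([ + suc i ] ≤⁺_) (≡.sym e) (_ ≤⊤⁺)) absurd
    exact [ + n ] e [ ℤ.+≤+ i≤n ] with n ℕ.≤? i
    ... | yes n≤i = ≡.cong (λ m → [ + m ]) (ℕ.≤-antisym n≤i i≤n)
    ... | no  n≰i = contradiction
          (≡.subst ([ + suc i ] ≤⁺_) (≡.sym e) [ ℤ.+≤+ (ℕ.≰⇒> n≰i) ]) absurd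

  -- Induction by 1 - xy = (1 - x) + x (1 - y).
  𝔭^-1-power : ∀ {n x} → 𝔭^ 0ℤ x → 𝔭^ n (1# - x) → ∀ m →
    𝔭^ n (1# - RawMonoidDefs._×_ *-rawMonoid m x)
  𝔭^-1-power         x∈O h zero    = 𝔭^-0 (-‿inverseʳ 1#)
  𝔭^-1-power {x = x} x∈O h (suc m) = 𝔭^-resp
    (solve 2 (λ x y → (con (1 , 0) :- x) :+ x :* (con (1 , 0) :- y) := con (1 , 0) :- x :* y)
      refl x (RawMonoidDefs._×_ *-rawMonoid m x))
    (𝔭^-+ h (𝔭^-*ˡ x∈O (𝔭^-1-power x∈O h m)))

  unit≉0 : ∀ {x} → Unit x → x ≉ 0#
  unit≉0 u e = 1∉𝔭 (𝔭^-resp isInverse (𝔭^-*ʳ (𝔭^-0 e) integral⁻¹))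
    where open Unit u

  -- Negative exponents reduce to positive ones because 1 - x⁻¹ = -x⁻¹ (1 - x) and x⁻¹ is integral.
  𝔭^-1-zpow : ∀ {n x} → Unit x → 𝔭^ n (1# - x) → ∀ k → 𝔭^ n (1# - zpow *-rawGroup x k)
  𝔭^-1-zpow         u h (+ m)    = 𝔭^-1-power (Unit.integral u) h m
  𝔭^-1-zpow {x = x} u h -[1+ m ] = 𝔭^-1-power x⁻¹∈O (𝔭^-resp 1-x⁻¹ (𝔭^-*ˡ (𝔭^-neg x⁻¹∈O) h)) (suc m)
    where
    xx⁻¹≈1 : x * x ⁻¹ ≈ 1#
    xx⁻¹≈1 = *-⁻¹ x (unit≉0 u)

    x⁻¹∈O : 𝔭^ 0ℤ (x ⁻¹)
    x⁻¹∈O = unit-cancel u (𝔭^-resp (sym xx⁻¹≈1) 𝔭⁰-1)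

    1-x⁻¹ : (- (x ⁻¹)) * (1# - x) ≈ 1# - x ⁻¹
    1-x⁻¹ = trans (solve 2 (λ x y → :- y :* (con (1 , 0) :- x) := x :* y :- y) refl x (x ⁻¹))
                  (+-congʳ xx⁻¹≈1)

  𝔭⁰-ℕ : ∀ n → 𝔭^ 0ℤ (n ×ₙ 1#)
  𝔭⁰-ℕ zero    = 𝔭^-0 refl
  𝔭⁰-ℕ (suc n) = 𝔭^-+ 𝔭⁰-1 (𝔭⁰-ℕ n)

  𝓞-× : ∀ n → n ×ₙ 1# ≈ proj₁ (RawMonoidDefs._×_ O.+-rawMonoid n O.1#)
  𝓞-× zero    = refl
  𝓞-× (suc n) = +-congˡ (𝓞-× n)

  -- v (1 − q⁻¹) = v (q − 1) for integral q with integral inverse w.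
  𝔭^-cancel-1-inverse : ∀ {m n q w y} → 𝔭^ 0ℤ q → q * w ≈ 1# →
    (k : K.Mem (q - 1#)) → v (q - 1# , k) ≡ [ n ] → K.Mem y →
    𝔭^ m ((1# - w) * y) → 𝔭^ (m ℤ.- n) y
  𝔭^-cancel-1-inverse {q = q} {w} {y} q∈O qw≈1 k e l h = 𝔭^-cancel k e l (𝔭^-resp
    (trans (solve 3 (λ q w y → q :* ((con (1 , 0) :- w) :* y) := (q :- q :* w) :* y) refl q w y)
      (*-congʳ (+-congˡ (-‿cong qw≈1))))
    (𝔭^-*ˡ q∈O h))

-- Intertwining of triangular matrices modulo λ.

module TriangularMatrices
  {ℓ : ℕ} (Q̄ : AlgebraicClosure ℓ) (K : Subfield (AlgebraicClosure.underlying Q̄))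
  (v : Field.Carrier (subfield (AlgebraicClosure.underlying Q̄) K) → ℤ ⁺)
  (normalized : IsNormalizedValuation Q̄ K v)
  where
  open AlgebraicClosure Q̄
  open Filtration Q̄ K v normalized
  open IntegerCoefficients commutativeRing
  open Matrices commutativeRing

  infix 4 _≡ᴹ_
  -- Congruence is defined over the ambient field because the entries are expressed through β, which
  -- need not be integral on its own.
  _≡ᴹ_ : Mat Carrier → Mat Carrier → Set
  mat a b c d ≡ᴹ mat a′ b′ c′ d′ =
    𝔭^ 1ℤ (a - a′) × 𝔭^ 1ℤ (b - b′) × 𝔭^ 1ℤ (c - c′) × 𝔭^ 1ℤ (d - d′)

  ≡ᴹ-resp : ∀ {M M′ N N′} → M ≈ᴹ M′ → N ≈ᴹ N′ → M ≡ᴹ N → M′ ≡ᴹ N′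
  ≡ᴹ-resp (a , b , c , d) (a′ , b′ , c′ , d′) (p , q , r , s) =
    along a a′ p , along b b′ q , along c c′ r , along d d′ s
    where
    along : ∀ {x x′ y y′} → x ≈ x′ → y ≈ y′ → 𝔭^ 1ℤ (x - y) → 𝔭^ 1ℤ (x′ - y′)
    along e e′ = 𝔭^-resp (+-cong e (-‿cong e′))

  *ᴹ-cong : ∀ {M M′ N N′} → M ≈ᴹ M′ → N ≈ᴹ N′ → M *ᴹ N ≈ᴹ M′ *ᴹ N′
  *ᴹ-cong (a , b , c , d) (a′ , b′ , c′ , d′) =
    +-cong (*-cong a a′) (*-cong b c′) , +-cong (*-cong a b′) (*-cong b d′) ,
    +-cong (*-cong c a′) (*-cong d c′) , +-cong (*-cong c b′) (*-cong d d′)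

  ≈ᴹ-refl : ∀ {M} → M ≈ᴹ M
  ≈ᴹ-refl = refl , refl , refl , refl

  ≈ᴹ-sym : ∀ {M N} → M ≈ᴹ N → N ≈ᴹ M
  ≈ᴹ-sym (a , b , c , d) = sym a , sym b , sym c , sym d

  ≈ᴹ-trans : ∀ {M N L} → M ≈ᴹ N → N ≈ᴹ L → M ≈ᴹ L
  ≈ᴹ-trans (a , b , c , d) (a′ , b′ , c′ , d′) = trans a a′ , trans b b′ , trans c c′ , trans d d′

  Intertwines : (P M N : Mat Carrier) → Set
  Intertwines P M N = P *ᴹ M ≡ᴹ N *ᴹ P

  intertwines-resp : ∀ {P M M′ N N′} → M ≈ᴹ M′ → N ≈ᴹ N′ → Intertwines P M N → Intertwines P M′ N′
  intertwines-resp e e′ = ≡ᴹ-resp (*ᴹ-cong ≈ᴹ-refl e) (*ᴹ-cong e′ ≈ᴹ-refl)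

  -- The value in HasTriangularForm, with c = χ(g), ω = ω(g), T = t(τ) and β = b/d.
  triangular : (u β c ω T : Carrier) → Mat Carrier
  triangular u β c ω T = mat (c * ω) (u * T * (c * ω) + β * (c - c * ω)) 0# c

  -- The possibly non-integral β disappears, its coefficient c - cω being 0.
  triangular-unipotent : ∀ u β c {ω T} → ω ≈ 1# → T ≈ 1# → triangular u β c ω T ≈ᴹ mat c (u * c) 0# c
  triangular-unipotent u β c {ω} {T} ω≈1 T≈1 =
    cω≈c ,
    trans (+-cong (*-cong (*-congˡ T≈1) cω≈c) (*-congˡ (+-congˡ (-‿cong cω≈c))))
      (solve 3 (λ u β c → u :* con (1 , 0) :* c :+ β :* (c :- c) := u :* c) refl u β c) ,
    refl , refl
    where
    cω≈c : c * ω ≈ c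
    cω≈c = trans (*-congˡ ω≈1) (*-identityʳ c)

  triangular-split : ∀ u β c ω {T} → T ≈ 0# → triangular u β c ω T ≈ᴹ mat (c * ω) (c * (β * (1# - ω))) 0# c
  triangular-split u β c ω {T} T≈0 =
    refl ,
    trans (+-congʳ (*-congʳ (*-congˡ T≈0)))
      (solve 4 (λ u β c ω → u :* con (0 , 0) :* (c :* ω) :+ β :* (c :- c :* ω)
                         := c :* (β :* (con (1 , 0) :- ω))) refl u β c ω) ,
    refl , refl

  -- Subtracting the integral term with `T` from the upper right entry leaves cβ(1 - ω), from which
  -- the unit `c` can be cancelled.
  offset-integral : ∀ {u β c ω T} → Unit c → 𝔭^ 0ℤ u → 𝔭^ 0ℤ ω → 𝔭^ 0ℤ T →
    𝔭^ 0ℤ (u * T * (c * ω) + β * (c - c * ω)) → 𝔭^ 0ℤ (β * (1# - ω))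
  offset-integral {u} {β} {c} {ω} {T} c× u∈O ω∈O T∈O h = unit-cancel c× (𝔭^-resp
    (solve 5 (λ u β c ω T → (u :* T :* (c :* ω) :+ β :* (c :- c :* ω)) :- u :* T :* (c :* ω)
                         := c :* (β :* (con (1 , 0) :- ω))) refl u β c ω T)
    (𝔭^-- h (𝔭^-*ˡ (𝔭^-*ˡ u∈O T∈O) (𝔭^-*ˡ (Unit.integral c×) ω∈O))))

  scaled-difference : ∀ {n u₁ u₂ β₁ β₂ δ} → 𝔭^ 0ℤ u₂ → 𝔭^ 0ℤ u₁ → 𝔭^ n (β₁ * δ) → 𝔭^ n (β₂ * δ) →
    𝔭^ n (δ * (u₂ * β₁ - u₁ * β₂))
  scaled-difference {u₁ = u₁} {u₂} {β₁} {β₂} {δ} u₂∈O u₁∈O f₁ f₂ = 𝔭^-resp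
    (solve 5 (λ δ u₁ u₂ β₁ β₂ → u₂ :* (β₁ :* δ) :- u₁ :* (β₂ :* δ) := δ :* (u₂ :* β₁ :- u₁ :* β₂))
      refl δ u₁ u₂ β₁ β₂)
    (𝔭^-- (𝔭^-*ˡ u₂∈O f₁) (𝔭^-*ˡ u₁∈O f₂))

  -- The second column of an inverse of (x y; z w) modulo λ is (y′; w′).
  module Intertwiner
    {x y z w y′ w′ : Carrier}
    (x∈O : 𝔭^ 0ℤ x) (y∈O : 𝔭^ 0ℤ y) (z∈O : 𝔭^ 0ℤ z) (w∈O : 𝔭^ 0ℤ w)
    (y′∈O : 𝔭^ 0ℤ y′) (w′∈O : 𝔭^ 0ℤ w′) (invertible : 𝔭^ 1ℤ (z * y′ + w * w′ - 1#))
    where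

    private
      P : Mat Carrier
      P = mat x y z w

    module Unipotent {u₁ u₂ c₀ t₀ : Carrier} (u₂× : Unit u₂) (t₀× : Unit t₀)
      (c₀∈O : 𝔭^ 0ℤ c₀) (u₁∈O : 𝔭^ 0ℤ u₁)
      (h : Intertwines P (mat c₀ (u₁ * c₀) 0# c₀) (mat t₀ (u₂ * t₀) 0# t₀))
      where

      -- x times the lower left entry of h minus z times its upper left entry is t₀ u₂ z².
      lower-left : 𝔭^ 1ℤ z
      lower-left = 𝔭-radical z∈O (unit-cancel u₂× (unit-cancel t₀× (𝔭^-resp
        (solve 7 (λ x y z w c t u →
            x :* ((z :* c :+ w :* con (0 , 0)) :- (con (0 , 0) :* x :+ t :* z))
              :- z :* ((x :* c :+ y :* con (0 , 0)) :- (t :* x :+ u :* t :* z))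
          := t :* (u :* (z :* z))) refl x y z w c₀ t₀ u₂)
        (𝔭^-- (𝔭^-*ˡ x∈O (proj₁ (proj₂ (proj₂ h)))) (𝔭^-*ˡ z∈O (proj₁ h))))))

      -- Once z ≡ 0, invertibility reads w w′ ≡ 1, so `w` can be cancelled modulo λ.
      lower-right : ∀ {s} → 𝔭^ 0ℤ s → 𝔭^ 1ℤ (w * s) → 𝔭^ 1ℤ s
      lower-right {s} s∈O h = 𝔭^-resp
        (solve 5 (λ z w y w′ s →
            (w′ :* (w :* s) :+ z :* (y :* s)) :- (z :* y :+ w :* w′ :- con (1 , 0)) :* s := s)
          refl z w y′ w′ s)
        (𝔭^-- (𝔭^-+ (𝔭^-*ˡ w′∈O h) (𝔭^-*ʳ lower-left (𝔭^-*ˡ y′∈O s∈O))) (𝔭^-*ʳ invertible s∈O))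

      -- The lower right entry of the intertwining relation is z b + w (d - d′), and z ≡ 0.
      congruent-characters : ∀ {a b d a′ b′ d′} → 𝔭^ 0ℤ b → 𝔭^ 0ℤ d → 𝔭^ 0ℤ d′ →
        Intertwines P (mat a b 0# d) (mat a′ b′ 0# d′) → 𝔭^ 1ℤ (d - d′)
      congruent-characters {b = b} {d} {d′ = d′} b∈O d∈O d′∈O (_ , _ , _ , k) =
        lower-right (𝔭^-- d∈O d′∈O) (𝔭^-resp
          (solve 6 (λ y z w b d d′ →
              ((z :* b :+ w :* d) :- (con (0 , 0) :* y :+ d′ :* w)) :- z :* b := w :* (d :- d′))
            refl y z w b d d′)
          (𝔭^-- k (𝔭^-*ʳ lower-left b∈O)))

      -- Since c₀ ≡ t₀, replacing `c₀` by `t₀` in the upper right entry of `h` cancels the terms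
      -- with `y` and leaves t₀ (x u₁ - w u₂).
      diagonal : 𝔭^ 1ℤ (x * u₁ - w * u₂)
      diagonal = unit-cancel t₀× (𝔭^-resp
        (solve 7 (λ x y w c t u₁ u₂ →
            ((x :* (u₁ :* c) :+ y :* c) :- (t :* y :+ u₂ :* t :* w)) :- (c :- t) :* (x :* u₁ :+ y)
          := t :* (x :* u₁ :- w :* u₂)) refl x y w c₀ t₀ u₁ u₂)
        (𝔭^-- (proj₁ (proj₂ h))
          (𝔭^-*ʳ (congruent-characters (𝔭^-*ˡ u₁∈O c₀∈O) c₀∈O (Unit.integral t₀×) h)
            (𝔭^-+ (𝔭^-*ˡ x∈O u₁∈O) y∈O))))

      -- Multiply the upper right entry by `u₁`, replace x u₁ by w u₂ and `t` by `c`; the terms with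
      -- `y` carry a factor 1 - ω or c - t and vanish modulo λ. What remains is w c times the
      -- desired element, and both factors cancel.
      offset : ∀ {c t ω β₁ β₂} → Unit c → 𝔭^ 0ℤ t → 𝔭^ 0ℤ ω → 𝔭^ 1ℤ (1# - ω) →
        𝔭^ 0ℤ (β₁ * (1# - ω)) → 𝔭^ 0ℤ (β₂ * (1# - ω)) →
        Intertwines P (mat (c * ω) (c * (β₁ * (1# - ω))) 0# c)
                      (mat (t * ω) (t * (β₂ * (1# - ω))) 0# t) →
        𝔭^ 1ℤ ((1# - ω) * (u₂ * β₁ - u₁ * β₂))
      offset {c} {t} {ω} {β₁} {β₂} c× t∈O ω∈O δ∈𝔭 f₁∈O f₂∈O k =
        unit-cancel c× (lower-right (𝔭^-*ˡ c∈O difference∈O) (𝔭^-resp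
          (solve 10 (λ x y w c t ω u₁ u₂ β₁ β₂ →
              let δ = con (1 , 0) :- ω in
              ((u₁ :* ((x :* (c :* (β₁ :* δ)) :+ y :* c)
                  :- (t :* ω :* y :+ t :* (β₂ :* δ) :* w))
                :- (x :* u₁ :- w :* u₂) :* (c :* (β₁ :* δ)))
                :- (δ :* (u₁ :* y :* c) :+ (c :- t) :* (u₁ :* y :* ω)))
                :- (c :- t) :* (u₁ :* w :* (β₂ :* δ))
              := w :* (c :* (δ :* (u₂ :* β₁ :- u₁ :* β₂))))
            refl x y w c t ω u₁ u₂ β₁ β₂)
          (𝔭^-- (𝔭^-- (𝔭^-- (𝔭^-*ˡ u₁∈O (proj₁ (proj₂ k)))
                            (𝔭^-*ʳ diagonal (𝔭^-*ˡ c∈O f₁∈O)))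
                      (𝔭^-+ (𝔭^-*ʳ δ∈𝔭 (𝔭^-*ˡ u₁y∈O c∈O)) (𝔭^-*ʳ c≡t (𝔭^-*ˡ u₁y∈O ω∈O))))
                (𝔭^-*ʳ c≡t (𝔭^-*ˡ (𝔭^-*ˡ u₁∈O w∈O) f₂∈O)))))
        where
        c∈O : 𝔭^ 0ℤ c
        c∈O = Unit.integral c×

        u₁y∈O : 𝔭^ 0ℤ (u₁ * y)
        u₁y∈O = 𝔭^-*ˡ u₁∈O y∈O

        c≡t : 𝔭^ 1ℤ (c - t)
        c≡t = congruent-characters (𝔭^-*ˡ c∈O f₁∈O) c∈O t∈O k

        difference∈O : 𝔭^ 0ℤ ((1# - ω) * (u₂ * β₁ - u₁ * β₂))
        difference∈O = scaled-difference (Unit.integral u₂×) u₁∈O f₁∈O f₂∈O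

  -- The last hypothesis is the part of the upper right entry of the conclusion that does not vanish
  -- with c − t.
  intertwiner : ∀ {u₁ u₂ β₁ β₂ y c t ω T} → 𝔭^ 0ℤ u₁ → 𝔭^ 0ℤ u₂ → 𝔭^ 0ℤ ω → 𝔭^ 0ℤ T →
    𝔭^ 0ℤ (β₂ * (1# - ω)) → 𝔭^ 1ℤ (c - t) →
    𝔭^ 1ℤ ((u₂ * β₁ - u₁ * β₂) * (c * (1# - ω)) + y * (c - t * ω)) →
    Intertwines (mat u₂ y 0# u₁) (triangular u₁ β₁ c ω T) (triangular u₂ β₂ t ω T)
  intertwiner {u₁} {u₂} {β₁} {β₂} {y} {c} {t} {ω} {T} u₁∈O u₂∈O ω∈O T∈O f₂∈O c≡t h =
    𝔭^-resp
      (solve 9 (λ y c t ω T u₁ u₂ β₁ β₂ → (c :- t) :* (u₂ :* ω)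
          := (u₂ :* (c :* ω) :+ y :* con (0 , 0))
             :- (t :* ω :* u₂ :+ (u₂ :* T :* (t :* ω) :+ β₂ :* (t :- t :* ω)) :* con (0 , 0)))
        refl y c t ω T u₁ u₂ β₁ β₂)
      (𝔭^-*ʳ c≡t (𝔭^-*ˡ u₂∈O ω∈O)) ,
    -- The diagonal `u₂`, `u₁` is chosen so that the terms with `T` agree up to a multiple of c - t.
    𝔭^-resp
      (solve 9 (λ y c t ω T u₁ u₂ β₁ β₂ →
          ((u₂ :* β₁ :- u₁ :* β₂) :* (c :* (con (1 , 0) :- ω)) :+ y :* (c :- t :* ω))
            :+ (c :- t) :* (u₁ :* (u₂ :* (T :* ω)) :+ u₁ :* (β₂ :* (con (1 , 0) :- ω)))
          := (u₂ :* (u₁ :* T :* (c :* ω) :+ β₁ :* (c :- c :* ω)) :+ y :* c)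
             :- (t :* ω :* y :+ (u₂ :* T :* (t :* ω) :+ β₂ :* (t :- t :* ω)) :* u₁))
        refl y c t ω T u₁ u₂ β₁ β₂)
      (𝔭^-+ h (𝔭^-*ʳ c≡t (𝔭^-+ (𝔭^-*ˡ u₁∈O (𝔭^-*ˡ u₂∈O (𝔭^-*ˡ T∈O ω∈O))) (𝔭^-*ˡ u₁∈O f₂∈O)))) ,
    𝔭^-0 (solve 5 (λ c t ω u₁ u₂ →
        (con (0 , 0) :* (c :* ω) :+ u₁ :* con (0 , 0)) :- (con (0 , 0) :* u₂ :+ t :* con (0 , 0))
        := con (0 , 0)) refl c t ω u₁ u₂) ,
    𝔭^-resp
      (solve 5 (λ c t y u₁ B → (c :- t) :* u₁
          := (con (0 , 0) :* B :+ u₁ :* c) :- (con (0 , 0) :* y :+ t :* u₁))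
        refl c t y u₁ (u₁ * T * (c * ω) + β₁ * (c - c * ω)))
      (𝔭^-*ʳ c≡t u₁∈O)

  -- With Y = u₂β₁ - u₁β₂, taking y = -Y turns the last hypothesis of `intertwiner` into -Yω(c - t)
  -- ∈ λ.
  intertwiner-integral : ∀ {u₁ u₂ β₁ β₂ c t ω T} → 𝔭^ 0ℤ u₁ → 𝔭^ 0ℤ u₂ → 𝔭^ 0ℤ ω → 𝔭^ 0ℤ T →
    𝔭^ 0ℤ (β₂ * (1# - ω)) → 𝔭^ 1ℤ (c - t) → 𝔭^ 0ℤ (u₂ * β₁ - u₁ * β₂) →
    Intertwines (mat u₂ (- (u₂ * β₁ - u₁ * β₂)) 0# u₁) (triangular u₁ β₁ c ω T) (triangular u₂ β₂ t ω T)
  intertwiner-integral {u₁} {u₂} {β₁} {β₂} {c} {t} {ω} u₁∈O u₂∈O ω∈O T∈O f₂∈O c≡t Y∈O =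
    intertwiner u₁∈O u₂∈O ω∈O T∈O f₂∈O c≡t (𝔭^-resp
      (solve 4 (λ y c t w → (:- (y :* w)) :* (c :- t)
          := y :* (c :* (con (1 , 0) :- w)) :+ (:- y) :* (c :- t :* w))
        refl (u₂ * β₁ - u₁ * β₂) c t ω)
      (𝔭^-*ˡ (𝔭^-neg (𝔭^-*ˡ Y∈O ω∈O)) c≡t))

  -- This serves the case i ≥ 1, where u₂β₁ - u₁β₂ may fail to be integral and hence cannot be a
  -- matrix entry, although its product with 1 - ω lies in λ.
  intertwiner-diagonal : ∀ {u₁ u₂ β₁ β₂ c t ω T} → 𝔭^ 0ℤ u₁ → 𝔭^ 0ℤ u₂ → 𝔭^ 0ℤ c → 𝔭^ 0ℤ ω → 𝔭^ 0ℤ T →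
    𝔭^ 0ℤ (β₂ * (1# - ω)) → 𝔭^ 1ℤ (c - t) → 𝔭^ 1ℤ ((u₂ * β₁ - u₁ * β₂) * (1# - ω)) →
    Intertwines (mat u₂ 0# 0# u₁) (triangular u₁ β₁ c ω T) (triangular u₂ β₂ t ω T)
  intertwiner-diagonal {u₁} {u₂} {β₁} {β₂} {c} {t} {ω} u₁∈O u₂∈O c∈O ω∈O T∈O f₂∈O c≡t h =
    intertwiner u₁∈O u₂∈O ω∈O T∈O f₂∈O c≡t (𝔭^-resp
      (solve 4 (λ y c t w → c :* (y :* (con (1 , 0) :- w))
          := y :* (c :* (con (1 , 0) :- w)) :+ con (0 , 0) :* (c :- t :* w))
        refl (u₂ * β₁ - u₁ * β₂) c t ω)
      (𝔭^-*ˡ c∈O h))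

  triangular-inverse : ∀ {u₁ u₂ u₁′ u₂′} y → u₁ * u₁′ ≈ 1# → u₂ * u₂′ ≈ 1# →
    let P = mat u₂ y 0# u₁; P⁻¹ = mat u₂′ (- (u₂′ * (y * u₁′))) 0# u₁′ in
    P⁻¹ *ᴹ P ≈ᴹ 1ᴹ × P *ᴹ P⁻¹ ≈ᴹ 1ᴹ
  triangular-inverse {u₁} {u₂} {u₁′} {u₂′} y u₁u₁′≈1 u₂u₂′≈1 =
    ( trans (solve 3 (λ u u′ s → u′ :* u :+ s :* con (0 , 0) := u :* u′) refl
        u₂ u₂′ (- (u₂′ * (y * u₁′)))) u₂u₂′≈1
    , trans (solve 4 (λ u₁ u₁′ u₂′ y → u₂′ :* y :+ (:- (u₂′ :* (y :* u₁′))) :* u₁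
        := (u₂′ :* y) :* (con (1 , 0) :- u₁ :* u₁′)) refl u₁ u₁′ u₂′ y) (vanish u₁u₁′≈1)
    , solve 2 (λ u u′ → con (0 , 0) :* u :+ u′ :* con (0 , 0) := con (0 , 0)) refl u₂ u₁′
    , trans (solve 3 (λ u u′ y → con (0 , 0) :* y :+ u′ :* u := u :* u′) refl u₁ u₁′ y) u₁u₁′≈1 ) ,
    ( trans (solve 3 (λ u u′ y → u :* u′ :+ y :* con (0 , 0) := u :* u′) refl u₂ u₂′ y) u₂u₂′≈1
    , trans (solve 4 (λ u₂ u₁′ u₂′ y → u₂ :* (:- (u₂′ :* (y :* u₁′))) :+ y :* u₁′
        := (y :* u₁′) :* (con (1 , 0) :- u₂ :* u₂′)) refl u₂ u₁′ u₂′ y) (vanish u₂u₂′≈1)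
    , solve 2 (λ u u′ → con (0 , 0) :* u′ :+ u :* con (0 , 0) := con (0 , 0)) refl u₁ u₂′
    , trans (solve 3 (λ u u′ s → con (0 , 0) :* s :+ u :* u′ := u :* u′) refl u₁ u₁′
        (- (u₂′ * (y * u₁′)))) u₁u₁′≈1 )
    where
    vanish : ∀ {x z} → z ≈ 1# → x * (1# - z) ≈ 0#
    vanish {x} e = trans (*-congˡ (trans (+-congˡ (-‿cong e)) (-‿inverseʳ 1#))) (zeroʳ x)

-- Writing elements of the Weil group as a power of Φ times inertia.

module FrobeniusDecomposition
  {p : ℕ} (F̄ : AlgebraicClosure p) (F : Subfield (AlgebraicClosure.underlying F̄))
  (F-finite : IsFiniteExtension F̄ F) (q : ℕ)
  where
  open AlgebraicClosure F̄ using (_≈_; refl; sym; trans; *-identityʳ)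
  open Weil F̄ F F-finite q
  open Automorphism

  frob-0 : ∀ {σ} → (∀ x → to σ x ≈ x) → ActsAsFrobenius^ 0 σ
  frob-0 e x = 𝕆⇒k̄ (trans (e (proj₁ x)) (sym (*-identityʳ (proj₁ x))))

  frob-0⇒trivial : ∀ {σ} → ActsAsFrobenius^ 0 σ → ActsTrivially σ
  frob-0⇒trivial f x = k̄.trans (f x) (𝕆⇒k̄ (*-identityʳ (proj₁ x)))

  module _ (Φ : W.Carrier) (geometric : IsGeometricFrobenius (proj₁ Φ)) where

    -- Φ is a geometric Frobenius, so it is the inverse of Φⁿ that acts by raising to the power qⁿ.
    inverse-of-power : ∀ n → ActsAsFrobenius^ n (inv (proj₁ (Φ ^ᵂ (+ n))))
    inverse-of-power zero    = frob-0 {inv (proj₁ (Φ ^ᵂ 0ℤ))} λ _ → refl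
    inverse-of-power (suc n) =
      -- Inverting Φ ∙ Φⁿ reverses the factors, so composition yields the exponent n + 1 instead of
      -- `suc n`.
      ≡.subst (λ m → ActsAsFrobenius^ m (inv (proj₁ (Φ ^ᵂ (+ suc n))))) (ℕ.+-comm n 1)
        (frob-resp (n ℕ.+ 1) {inv (proj₁ (Φ ^ᵂ (+ n))) ∙ inv (proj₁ Φ)} {inv (proj₁ (Φ ^ᵂ (+ suc n)))}
          (λ _ → refl)
          (frob-comp n 1 {inv (proj₁ (Φ ^ᵂ (+ n)))} {inv (proj₁ Φ)} (inverse-of-power n) geometric))

    power-of-inverse : ∀ n → ActsAsFrobenius^ n (proj₁ (RawMonoidDefs._×_ W.rawMonoid n (Φ W.⁻¹)))
    power-of-inverse zero    = frob-0 {1ᴬ} λ _ → refl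
    power-of-inverse (suc n) =
      frob-comp 1 n {inv (proj₁ Φ)} {proj₁ (RawMonoidDefs._×_ W.rawMonoid n (Φ W.⁻¹))}
        geometric (power-of-inverse n)

    negative-power : ∀ n → ActsAsFrobenius^ n (proj₁ (Φ ^ᵂ (ℤ.- + n)))
    negative-power zero    = power-of-inverse zero
    negative-power (suc n) = power-of-inverse (suc n)

    quotient-by : ∀ k g → ActsTrivially (inv (proj₁ (Φ ^ᵂ k)) ∙ proj₁ g) →
      ∃[ j ] Σ[ τ ∈ I.Carrier ] Φ ^ᵂ j W.∙ proj₁ τ W.≈ g
    quotient-by k g trivial =
      k , ((Φ ^ᵂ k) W.⁻¹ W.∙ g , trivial) , λ x → to∘from (proj₁ (Φ ^ᵂ k)) (to (proj₁ g) x)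

    -- The matching power of Φ is Φ⁻ⁿ if `g` acts as the qⁿ-th power, and Φⁿ if its inverse does;
    -- the quotient then acts with exponent q⁰ and is inertial. This carries the triangular forms,
    -- known on the elements Φᵏτ, to all of W_F.
    decompose : ∀ g → ∃[ k ] Σ[ τ ∈ I.Carrier ] Φ ^ᵂ k W.∙ proj₁ τ W.≈ g
    decompose g@(σ , n , inj₁ f) = quotient-by (ℤ.- + n) g (frob-0⇒trivial {inv φ ∙ σ}
      (frob-cancelˡ n 0 {inv φ} {σ}
        (frob-resp n {φ} {inv (inv φ)} (λ _ → refl) (negative-power n))
        (≡.subst (λ m → ActsAsFrobenius^ m σ) (≡.sym (ℕ.+-identityʳ n)) f)))
      where
      φ : Automorphism
      φ = proj₁ (Φ ^ᵂ (ℤ.- + n))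
    decompose g@(σ , n , inj₂ f) = quotient-by (+ n) g (frob-0⇒trivial {inv φ ∙ σ}
      (frob-cancelʳ n 0 {inv φ} {σ}
        (≡.subst (λ m → ActsAsFrobenius^ m (inv φ)) (≡.sym (ℕ.+-identityʳ n)) (inverse-of-power n))
        f))
      where
      φ : Automorphism
      φ = proj₁ (Φ ^ᵂ (+ n))

-- Comparison of the reductions of two special representations.

module SpecialPair
  {p ℓ : ℕ} (F̄ : AlgebraicClosure p) (F : Subfield (AlgebraicClosure.underlying F̄))
  (F-finite : IsFiniteExtension F̄ F) (q : ℕ) (Q̄ : AlgebraicClosure ℓ)
  where
  open Weil F̄ F F-finite q
  open Representations F̄ F F-finite q Q̄

  module _
    (Φ : W.Carrier) (geometric : IsGeometricFrobenius (proj₁ Φ))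
    (ω : Character) (isOmega : IsOmega Φ ω) (t : TameCharacter ω)
    (K : Subfield (AlgebraicClosure.underlying Q̄)) (K-finite : IsFiniteExtension Q̄ K)
    (v : Field.Carrier (subfield (AlgebraicClosure.underlying Q̄) K) → ℤ ⁺)
    (normalized : IsNormalizedValuation Q̄ K v)
    where
    open Reduction K
    open AlgebraicClosure Q̄
    open Filtration Q̄ K v normalized
    open TriangularMatrices Q̄ K v normalized
    open IntegerCoefficients commutativeRing
    open Matrices commutativeRing
    open FrobeniusDecomposition F̄ F F-finite q
    private
      module K = Subfield K
      module t = IsGroupHomomorphism (TameCharacter.isHom t)
      module ι = IsRingMonomorphism ι-mono

    -- The residue field is the quotient by the non-units, so passing between it and the filtration
    -- rests on non-units being exactly the elements of `𝔭^ 1ℤ`.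
    ≡ₖ⇒𝔭 : ∀ {X Y} → X k.≈ Y → 𝔭^ 1ℤ (proj₁ X - proj₁ Y)
    ≡ₖ⇒𝔭 {X} {Y} (congruent n) = nonunit⇒𝔭¹ (proj₂ (X O.- Y)) n

    𝔭⇒≡ₖ : ∀ {X Y} → 𝔭^ 1ℤ (proj₁ X - proj₁ Y) → X k.≈ Y
    𝔭⇒≡ₖ {X} {Y} h = congruent (𝔭¹⇒nonunit (proj₂ (X O.- Y)) h)

    ≈⇒≡ₖ : ∀ {X Y} → proj₁ X ≈ proj₁ Y → X k.≈ Y
    ≈⇒≡ₖ {Y = Y} e = 𝔭⇒≡ₖ (𝔭^-0 (trans (+-congʳ e) (-‿inverseʳ (proj₁ Y))))

    forget : Mat O.Carrier → Mat Carrier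
    forget (mat a b c d) = mat (proj₁ a) (proj₁ b) (proj₁ c) (proj₁ d)

    ≡ₖᴹ⇒≡ᴹ : ∀ {M N} → Matrices._≈ᴹ_ k M N → forget M ≡ᴹ forget N
    ≡ₖᴹ⇒≡ᴹ (a , b , c , d) = ≡ₖ⇒𝔭 a , ≡ₖ⇒𝔭 b , ≡ₖ⇒𝔭 c , ≡ₖ⇒𝔭 d

    ≡ᴹ⇒≡ₖᴹ : ∀ {M N} → forget M ≡ᴹ forget N → Matrices._≈ᴹ_ k M N
    ≡ᴹ⇒≡ₖᴹ (a , b , c , d) = 𝔭⇒≡ₖ a , 𝔭⇒≡ₖ b , 𝔭⇒≡ₖ c , 𝔭⇒≡ₖ d

    ≈ᴹ⇒≡ₖᴹ : ∀ {M N} → forget M ≈ᴹ forget N → Matrices._≈ᴹ_ k M N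
    ≈ᴹ⇒≡ₖᴹ (a , b , c , d) = ≈⇒≡ₖ a , ≈⇒≡ₖ b , ≈⇒≡ₖ c , ≈⇒≡ₖ d

    integral : (X : O.Carrier) → 𝔭^ 0ℤ (proj₁ X)
    integral X = integral⇒𝔭⁰ (proj₂ X)

    -- The value is the image of some `a` in ℤ_ℓ: it lies in K with denominator ℓ⁰, and it is a root
    -- of the monic polynomial X - a.
    T-integral : ∀ τ → 𝔭^ 0ℤ (T Φ ω t τ)
    T-integral τ = integral⇒𝔭⁰
      ( IsFiniteExtension.ℚₚ⊆ K-finite (0 , a , *-identityˡ (ι a))
      , (CommutativeRing.-_ (ℤ-adic ℓ) a ∷ [])
      , trans (+-cong (ι.-‿homo a) (*-identityʳ (ι a))) (-‿inverseˡ (ι a)) )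
      where
      a : PAdicInt ℓ
      a = TameCharacter.value t τ

    module Form (ρ : Representation) (int : IsIntegralRep ρ) (χ : Character) {u β : Carrier}
                (form : HasTriangularForm Φ ω t ρ χ u β) where

      private
        module ρ = IsMonoidHomomorphism (Representation.isHom ρ)
        module χ = IsMonoidHomomorphism (Character.isHom χ)

      χ· : W.Carrier → Carrier
      χ· = Character.value χ

      module _ (k : ℤ) (τ : I.Carrier) where
        private
          g : W.Carrier
          g = Φ ^ᵂ k W.∙ proj₁ τ

          open InGL₂O (int g)

          c w y : Carrier
          c = χ· g
          w = ω· Φ ω t g
          y = proj₁ (proj₁ det-unit)

          y∈O : 𝔭^ 0ℤ y
          y∈O = integral⇒𝔭⁰ (proj₂ (proj₁ det-unit))

          c∈O : 𝔭^ 0ℤ c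
          c∈O = 𝔭^-resp (proj₂ (proj₂ (proj₂ (form k τ)))) (integral⇒𝔭⁰ m₂₂)

          cw∈O : 𝔭^ 0ℤ (c * w)
          cw∈O = 𝔭^-resp (proj₁ (form k τ)) (integral⇒𝔭⁰ m₁₁)

          determinant : ((c * w) * c) * y ≈ 1#
          determinant = trans (*-congʳ (trans
              (solve 3 (λ c w b → (c :* w) :* c := (c :* w) :* c :- b :* con (0 , 0))
                refl c w (Mat.e₁₂ (Representation.value ρ g)))
              (sym (+-cong (*-cong (proj₁ (form k τ)) (proj₂ (proj₂ (proj₂ (form k τ)))))
                (-‿cong (*-congˡ (proj₁ (proj₂ (proj₂ (form k τ))))))))))
            (proj₂ det-unit)

        -- The determinant c²ω is a unit and both diagonal entries are integral, so cω times the
        -- inverse determinant inverts `c`; the same argument then inverts ω.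
        character-unit : Unit c
        character-unit = record
          { integral   = c∈O
          ; inverse    = (c * w) * y
          ; integral⁻¹ = 𝔭^-*ˡ cw∈O y∈O
          ; isInverse  = trans (solve 3 (λ c w y → c :* ((c :* w) :* y) := ((c :* w) :* c) :* y) refl c w y)
                           determinant
          }

        cyclotomic-unit : Unit w
        cyclotomic-unit = record
          { integral   = unit-cancel character-unit cw∈O
          ; inverse    = (c * c) * y
          ; integral⁻¹ = 𝔭^-*ˡ (𝔭^-*ˡ c∈O c∈O) y∈O
          ; isInverse  = trans (solve 3 (λ c w y → w :* ((c :* c) :* y) := ((c :* w) :* c) :* y) refl c w y)
                           determinant
          }

        upper-right-integral : 𝔭^ 0ℤ (u * T Φ ω t τ * (c * w) + β * (c - c * w))
        upper-right-integral = 𝔭^-resp (proj₁ (proj₂ (form k τ))) (integral⇒𝔭⁰ m₁₂)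

      normalForm : ℤ → I.Carrier → Mat Carrier
      normalForm k τ = triangular u β (χ· (Φ ^ᵂ k W.∙ proj₁ τ)) (ω· Φ ω t (Φ ^ᵂ k W.∙ proj₁ τ)) (T Φ ω t τ)

      normalForm≈ : ∀ k τ {g} → Φ ^ᵂ k W.∙ proj₁ τ W.≈ g → normalForm k τ ≈ᴹ Representation.value ρ g
      normalForm≈ k τ {g} e =
        ≈ᴹ-trans {normalForm k τ} {Representation.value ρ g′} {Representation.value ρ g}
          (≈ᴹ-sym {Representation.value ρ g′} {normalForm k τ} (form k τ)) (ρ.⟦⟧-cong {g′} {g} e)
        where
        g′ : W.Carrier
        g′ = Φ ^ᵂ k W.∙ proj₁ τ

    module Comparison
      (ρ₁ ρ₂ : Representation) (int₁ : IsIntegralRep ρ₁) (int₂ : IsIntegralRep ρ₂)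
      (χ θ : Character) {u₁ β₁ u₂ β₂ : Carrier}
      (form₁ : HasTriangularForm Φ ω t ρ₁ χ u₁ β₁) (form₂ : HasTriangularForm Φ ω t ρ₂ θ u₂ β₂)
      (u₁× : Unit u₁) (u₂× : Unit u₂) (β₁∈K : Subfield.Mem K β₁) (β₂∈K : Subfield.Mem K β₂)
      {i : ℕ} (q-1∈K : Subfield.Mem K (q ×ₙ 1# - 1#)) (v-q-1 : v (q ×ₙ 1# - 1# , q-1∈K) ≡ [ + i ])
      where

      private
        module X₁ = Form ρ₁ int₁ χ form₁
        module X₂ = Form ρ₂ int₂ θ form₂
        module χ = IsMonoidHomomorphism (Character.isHom χ)
        module θ = IsMonoidHomomorphism (Character.isHom θ)

        u₁∈O : 𝔭^ 0ℤ u₁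
        u₁∈O = Unit.integral u₁×

        u₂∈O : 𝔭^ 0ℤ u₂
        u₂∈O = Unit.integral u₂×

        Y : Carrier
        Y = u₂ * β₁ - u₁ * β₂

        g : ℤ → I.Carrier → W.Carrier
        g k τ = Φ ^ᵂ k W.∙ proj₁ τ

        χ· θ· w : ℤ → I.Carrier → Carrier
        χ· k τ = Character.value χ (g k τ)
        θ· k τ = Character.value θ (g k τ)
        w k τ = ω· Φ ω t (g k τ)

        w∈O : ∀ k τ → 𝔭^ 0ℤ (w k τ)
        w∈O k τ = Unit.integral (X₁.cyclotomic-unit k τ)

        Y∈K : Subfield.Mem K Y
        Y∈K = K.+-mem (K.*-mem (proj₁ u₂∈O) β₁∈K) (K.neg-mem (K.*-mem (proj₁ u₁∈O) β₂∈K))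

      q*w≈1 : (q ×ₙ 1#) * w 1ℤ I.ε ≈ 1#
      q*w≈1 = trans (*-congˡ w≈q⁻¹) (*-⁻¹ (q ×ₙ 1#) q≉0)
        where
        w≈q⁻¹ : w 1ℤ I.ε ≈ (q ×ₙ 1#) ⁻¹
        w≈q⁻¹ = trans (isOmega 1ℤ I.ε) (*-identityʳ ((q ×ₙ 1#) ⁻¹))

        -- By the convention 0⁻¹ = 0, vanishing of q would force ω(Φ) = 0, although ω(Φ) is a unit.
        q≉0 : q ×ₙ 1# ≉ 0#
        q≉0 e = unit≉0 (X₁.cyclotomic-unit 1ℤ I.ε) (trans w≈q⁻¹ (trans (⁻¹-cong e) 0⁻¹≈0))

      q-unit : Unit (q ×ₙ 1#)
      q-unit = record
        { integral = 𝔭⁰-ℕ q ; inverse = w 1ℤ I.ε ; integral⁻¹ = w∈O 1ℤ I.ε ; isInverse = q*w≈1 }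

      -- Each ω(Φᵏτ) is an integral power of q, a unit congruent to 1 modulo λⁱ.
      1-w∈𝔭ⁱ : ∀ k τ → 𝔭^ (+ i) (1# - w k τ)
      1-w∈𝔭ⁱ k τ = 𝔭^-resp (+-congˡ (-‿cong (sym (isOmega k τ))))
        (𝔭^-1-zpow q-unit
          (𝔭^-resp (solve 1 (λ x → :- (x :- con (1 , 0)) := con (1 , 0) :- x) refl (q ×ₙ 1#))
            (𝔭^-neg (q-1∈K , ≡.subst ([ + i ] ≤⁺_) (≡.sym v-q-1) [ ℤ.≤-refl ])))
          (ℤ.- k))

      divide-Frobenius : ∀ {n} → 𝔭^ n ((1# - w 1ℤ I.ε) * Y) → 𝔭^ (n ℤ.- + i) Y
      divide-Frobenius = 𝔭^-cancel-1-inverse (𝔭⁰-ℕ q) q*w≈1 q-1∈K v-q-1 Y∈K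

      offset₁ : ∀ k τ → 𝔭^ 0ℤ (β₁ * (1# - w k τ))
      offset₁ k τ = offset-integral (X₁.character-unit k τ) u₁∈O (w∈O k τ) (T-integral τ)
        (X₁.upper-right-integral k τ)

      offset₂ : ∀ k τ → 𝔭^ 0ℤ (β₂ * (1# - w k τ))
      offset₂ k τ = offset-integral (X₂.character-unit k τ) u₂∈O (w∈O k τ) (T-integral τ)
        (X₂.upper-right-integral k τ)

      sameReduction⇒ : SameReduction χ θ → ∀ h → 𝔭^ 1ℤ (Character.value χ h - Character.value θ h)
      sameReduction⇒ same h = ≡ₖ⇒𝔭 (proj₂ (proj₂ (same h)))

      ⇒sameReduction : (∀ k τ → 𝔭^ 1ℤ (χ· k τ - θ· k τ)) → SameReduction χ θ
      ⇒sameReduction same h = transport (decompose Φ geometric h)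
        where
        transport : ∃[ k ] Σ[ τ ∈ I.Carrier ] g k τ W.≈ h →
          Σ[ m ∈ InO (Character.value χ h) ] Σ[ n ∈ InO (Character.value θ h) ]
            (Character.value χ h , m) k.≈ (Character.value θ h , n)
        transport (k , τ , e) =
          𝔭⁰⇒integral (𝔭^-resp χ-e (Unit.integral (X₁.character-unit k τ))) ,
          𝔭⁰⇒integral (𝔭^-resp θ-e (Unit.integral (X₂.character-unit k τ))) ,
          𝔭⇒≡ₖ (𝔭^-resp (+-cong χ-e (-‿cong θ-e)) (same k τ))
          where
          χ-e : χ· k τ ≈ Character.value χ h
          χ-e = χ.⟦⟧-cong {g k τ} {h} e

          θ-e : θ· k τ ≈ Character.value θ h
          θ-e = θ.⟦⟧-cong {g k τ} {h} e

      -- From isomorphic reductions to the bound.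

      module Forward
        (iso : Matrices.Isomorphic k (reduction ρ₁ int₁) (reduction ρ₂ int₂)) where
        private
          module C = Matrices.Conjugator (proj₁ iso)

          P : Mat Carrier
          P = forget C.P

          intertwines : ∀ k τ → Intertwines P (X₁.normalForm k τ) (X₂.normalForm k τ)
          intertwines k τ = intertwines-resp {P} {_} {X₁.normalForm k τ} {_} {X₂.normalForm k τ}
            (form₁ k τ) (form₂ k τ) (≡ₖᴹ⇒≡ᴹ (proj₂ iso (g k τ)))

          τ₁ : I.Carrier
          τ₁ = proj₁ (TameCharacter.surjective t (CommutativeRing.1# (ℤ-adic ℓ)))

          T-τ₁ : T Φ ω t τ₁ ≈ 1#
          T-τ₁ = trans (ι.⟦⟧-cong (proj₂ (TameCharacter.surjective t (CommutativeRing.1# (ℤ-adic ℓ)))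
                         {τ₁} (λ _ → AlgebraicClosure.refl F̄))) ι.1#-homo

          T-ε : T Φ ω t I.ε ≈ 0#
          T-ε = trans (ι.⟦⟧-cong t.ε-homo) ι.0#-homo

          -- The last argument is the lower right entry of P P⁻¹ ≡ 1.
          open Intertwiner (integral (Mat.e₁₁ C.P)) (integral (Mat.e₁₂ C.P)) (integral (Mat.e₂₁ C.P))
            (integral (Mat.e₂₂ C.P)) (integral (Mat.e₁₂ C.P⁻¹)) (integral (Mat.e₂₂ C.P⁻¹))
            (≡ₖ⇒𝔭 (proj₂ (proj₂ (proj₂ C.inverseʳ))))

          -- For k = 0 the power of q in `isOmega` computes to 1, so ω is trivial at τ₁.
          open Unipotent u₂× (X₂.character-unit 0ℤ τ₁)
            (Unit.integral (X₁.character-unit 0ℤ τ₁)) u₁∈O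
            (intertwines-resp
              (triangular-unipotent u₁ β₁ (χ· 0ℤ τ₁) (isOmega 0ℤ τ₁) T-τ₁)
              (triangular-unipotent u₂ β₂ (θ· 0ℤ τ₁) (isOmega 0ℤ τ₁) T-τ₁)
              (intertwines 0ℤ τ₁))

        sameReduction : SameReduction χ θ
        sameReduction = ⇒sameReduction λ k τ → congruent-characters
          (X₁.upper-right-integral k τ) (Unit.integral (X₁.character-unit k τ))
          (Unit.integral (X₂.character-unit k τ)) (intertwines k τ)

        bound : 𝔭^ (0ℤ ℤ.⊓ (1ℤ ℤ.- + i)) Y
        bound = by-cases i ≡.refl
          where
          δ∈𝔭ⁱ : 𝔭^ (+ i) (1# - w 1ℤ I.ε)
          δ∈𝔭ⁱ = 1-w∈𝔭ⁱ 1ℤ I.ε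

          by-cases : ∀ j → i ≡ j → 𝔭^ (0ℤ ℤ.⊓ (1ℤ ℤ.- + i)) Y
          -- For i = 0 the minimum is 0, and integrality of the upper right entries at Φ gives it.
          by-cases zero    ≡.refl = divide-Frobenius
            (scaled-difference u₂∈O u₁∈O (offset₁ 1ℤ I.ε) (offset₂ 1ℤ I.ε))
          -- For i ≥ 1 the congruence puts (1 - ω(Φ)) Y in λ, so dividing by 1 - ω(Φ) leaves
          -- exponent 1 - i.
          by-cases (suc n) ≡.refl = 𝔭^-mono (ℤ.i⊓j≤j 0ℤ (1ℤ ℤ.- + i)) (divide-Frobenius
            (offset (X₁.character-unit 1ℤ I.ε) (Unit.integral (X₂.character-unit 1ℤ I.ε)) (w∈O 1ℤ I.ε)
              (𝔭^-mono (ℤ.+≤+ (ℕ.s≤s ℕ.z≤n)) δ∈𝔭ⁱ) (offset₁ 1ℤ I.ε) (offset₂ 1ℤ I.ε)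
              (intertwines-resp
                (triangular-split u₁ β₁ (χ· 1ℤ I.ε) (w 1ℤ I.ε) T-ε)
                (triangular-split u₂ β₂ (θ· 1ℤ I.ε) (w 1ℤ I.ε) T-ε)
                (intertwines 1ℤ I.ε))))

      -- From the bound to an explicit isomorphism.

      module Backward (same : SameReduction χ θ) (bound : 𝔭^ (0ℤ ℤ.⊓ (1ℤ ℤ.- + i)) Y) where

        -- Both representations respect equality in W_F, so by `decompose` intertwining need only be
        -- checked on the triangular forms.
        conjugate : ∀ {y} → 𝔭^ 0ℤ y →
          (∀ k τ → Intertwines (mat u₂ y 0# u₁) (X₁.normalForm k τ) (X₂.normalForm k τ)) →
          Matrices.Isomorphic k (reduction ρ₁ int₁) (reduction ρ₂ int₂)
        conjugate {y} y∈O h = record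
          { P        = mat (u₂ , 𝔭⁰⇒integral u₂∈O) (y , 𝔭⁰⇒integral y∈O) O.0# (u₁ , 𝔭⁰⇒integral u₁∈O)
          ; P⁻¹      = mat (u₂′ , 𝔭⁰⇒integral u₂′∈O) (- (u₂′ * (y * u₁′)) ,
                         𝔭⁰⇒integral (𝔭^-neg (𝔭^-*ˡ u₂′∈O (𝔭^-*ˡ y∈O u₁′∈O))))
                         O.0# (u₁′ , 𝔭⁰⇒integral u₁′∈O)
          ; inverseˡ = ≈ᴹ⇒≡ₖᴹ (proj₁ (triangular-inverse y u₁u₁′≈1 u₂u₂′≈1))
          ; inverseʳ = ≈ᴹ⇒≡ₖᴹ (proj₂ (triangular-inverse y u₁u₁′≈1 u₂u₂′≈1))
          } , λ f → ≡ᴹ⇒≡ₖᴹ (intertwines f)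
          where
          open Unit u₁× using () renaming (inverse to u₁′; integral⁻¹ to u₁′∈O; isInverse to u₁u₁′≈1)
          open Unit u₂× using () renaming (inverse to u₂′; integral⁻¹ to u₂′∈O; isInverse to u₂u₂′≈1)

          intertwines : ∀ f →
            Intertwines (mat u₂ y 0# u₁) (Representation.value ρ₁ f) (Representation.value ρ₂ f)
          intertwines f = transport (decompose Φ geometric f)
            where
            transport : ∃[ k ] Σ[ τ ∈ I.Carrier ] g k τ W.≈ f →
              Intertwines (mat u₂ y 0# u₁) (Representation.value ρ₁ f) (Representation.value ρ₂ f)
            transport (k , τ , e) = intertwines-resp
              {mat u₂ y 0# u₁} {X₁.normalForm k τ} {Representation.value ρ₁ f}
              {X₂.normalForm k τ} {Representation.value ρ₂ f}
              (X₁.normalForm≈ k τ {f} e) (X₂.normalForm≈ k τ {f} e) (h k τ)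

        isomorphic : Matrices.Isomorphic k (reduction ρ₁ int₁) (reduction ρ₂ int₂)
        isomorphic = by-cases i ≡.refl
          where
          by-cases : ∀ j → i ≡ j → Matrices.Isomorphic k (reduction ρ₁ int₁) (reduction ρ₂ int₂)
          by-cases zero    ≡.refl = conjugate (𝔭^-neg bound) λ k τ →
            intertwiner-integral u₁∈O u₂∈O (w∈O k τ) (T-integral τ) (offset₂ k τ)
              (sameReduction⇒ same (g k τ)) bound
          by-cases (suc n) ≡.refl = conjugate (𝔭^-0 refl) λ k τ →
            intertwiner-diagonal u₁∈O u₂∈O (Unit.integral (X₁.character-unit k τ)) (w∈O k τ) (T-integral τ)
              (offset₂ k τ) (sameReduction⇒ same (g k τ))
              -- For i ≥ 1 the minimum is 1 - i and 1 - ω contributes i, which adds up to 1.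
              (≡.subst (λ m → 𝔭^ m (Y * (1# - w k τ))) (exponent n) (𝔭^-* bound (1-w∈𝔭ⁱ k τ)))
            where
            exponent : ∀ n → 0ℤ ℤ.⊓ (1ℤ ℤ.- + suc n) ℤ.+ + suc n ≡ 1ℤ
            exponent n = ≡.trans
              (≡.cong (λ m → m ℤ.+ + suc n) (ℤ.i≥j⇒i⊓j≡j (ℤ.i≤j⇒i-j≤0 (ℤ.+≤+ (ℕ.s≤s (ℕ.z≤n {n}))))))
              (≡.trans (ℤ.+-assoc 1ℤ (ℤ.- + suc n) (+ suc n))
                (≡.cong (λ m → 1ℤ ℤ.+ m) (ℤ.+-inverseˡ (+ suc n))))

      -- Here `X` is the quotient in the statement; since `u₁` is a unit, bounds for `X` and `Y` are
      -- interchangeable.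
      equivalence : (X : Carrier) (X∈K : Subfield.Mem K X) → Y ≈ u₁ * X →
        Matrices.Isomorphic k (reduction ρ₁ int₁) (reduction ρ₂ int₂)
          ⇔ (SameReduction χ θ × [ 0ℤ ℤ.⊓ (1ℤ ℤ.- + i) ] ≤⁺ v (X , X∈K))
      equivalence X X∈K Y≈u₁X = mk⇔
        (λ iso → Forward.sameReduction iso ,
                 𝔭^⇒v (unit-cancel u₁× (𝔭^-resp Y≈u₁X (Forward.bound iso))) X∈K)
        (λ (same , h) → Backward.isomorphic same (𝔭^-resp (sym Y≈u₁X) (𝔭^-*ˡ u₁∈O (X∈K , h))))

-- The criterion for isomorphic reductions.

proposition3p12 :
  (p ℓ : ℕ) → Prime p → Prime ℓ → p ≢ 2 → ℓ ≢ 2 → p ≢ ℓ →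
  (F̄ : AlgebraicClosure p)
  (F : Subfield (AlgebraicClosure.underlying F̄)) (F-finite : IsFiniteExtension F̄ F)
  (q : ℕ) → HasResidueOrder F̄ F q →
  (Q̄ : AlgebraicClosure ℓ) →
  let open Weil F̄ F F-finite q
      open Representations F̄ F F-finite q Q̄
  in
  (Φ : W.Carrier) → IsGeometricFrobenius (proj₁ Φ) →
  (ω : Character) → IsOmega Φ ω →
  (t : TameCharacter ω) →
  (K : Subfield (AlgebraicClosure.underlying Q̄)) → IsFiniteExtension Q̄ K →
  let open Reduction K
      open Field (subfield (AlgebraicClosure.underlying Q̄) K)
  in
  (v : Carrier → ℤ ⁺) → IsNormalizedValuation Q̄ K v →
  (ρ₁ ρ₂ : Representation) (int₁ : IsIntegralRep ρ₁) (int₂ : IsIntegralRep ρ₂)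
  (χ θ : Character) →
  IsSpecialFor Φ ω t ρ₁ χ → IsSpecialFor Φ ω t ρ₂ θ →
  (a₁ b₁ d₁ a₂ b₂ d₂ : Carrier) → a₁ * d₁ ≉ 0# → a₂ * d₂ ≉ 0# →
  HasTriangularForm Φ ω t ρ₁ χ (proj₁ (a₁ / d₁)) (proj₁ (b₁ / d₁)) →
  HasTriangularForm Φ ω t ρ₂ θ (proj₁ (a₂ / d₂)) (proj₁ (b₂ / d₂)) →
  IsUnitOfO (proj₁ (a₁ / d₁)) → IsUnitOfO (proj₁ (a₂ / d₂)) →
  (i : ℕ) → IsMaximalCongruence i →
  Matrices.Isomorphic k (reduction ρ₁ int₁) (reduction ρ₂ int₂)
    ⇔ (SameReduction χ θ ×
       [ 0ℤ ℤ.⊓ (1ℤ ℤ.- + i) ] ≤⁺ v ((a₂ * b₁ - a₁ * b₂) / (a₁ * d₂)))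
proposition3p12 p ℓ _ _ _ _ _ F̄ F F-finite q _ Q̄ Φ geometric ω isOmega t K K-finite v normalized
  ρ₁ ρ₂ int₁ int₂ χ θ _ _ a₁ b₁ d₁ a₂ b₂ d₂ a₁d₁≉0 a₂d₂≉0 form₁ form₂ (m₁ , unit₁) (m₂ , unit₂)
  i (i-power , i-maximal) =
  SpecialPair.Comparison.equivalence F̄ F F-finite q Q̄ Φ geometric ω isOmega t K K-finite v normalized
    ρ₁ ρ₂ int₁ int₂ χ θ form₁ form₂ (V.unit m₁ unit₁) (V.unit m₂ unit₂)
    (proj₂ (b₁ K./ d₁)) (proj₂ (b₂ K./ d₂)) {i} q-1∈K
    -- The integer `i` refers to q - 1 formed in 𝓞, the valuation to q - 1 formed in the ambient
    -- field; `𝓞-×` reconciles the two.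
    (V.maximal-power⇒v i-power i-maximal q-1∈K (E.+-congʳ (V.𝓞-× q)))
    (proj₁ X) (proj₂ X)
    (cross-difference (subfield E.underlying K) {a₁} {d₁} {a₂} {d₂} b₁ b₂ a₁d₁≉0 a₂d₂≉0)
  where
  module E = AlgebraicClosure Q̄
  module V = Filtration Q̄ K v normalized
  module K = Field (subfield E.underlying K)

  X : K.Carrier
  X = (a₂ K.* b₁ K.- a₁ K.* b₂) K./ (a₁ K.* d₂)

  q-1∈K : Subfield.Mem K (q E.×ₙ E.1# E.- E.1#)
  q-1∈K = proj₁ (V.𝔭^-- (V.𝔭⁰-ℕ q) V.𝔭⁰-1)
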